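{- Let $d\ge1$ and let $\mathcal{F}\subseteq \binom{\mathbb{N}}{d}$ be a finite family of $d$-sets. Then $\mathrm{Inc}(\mathcal{C}(\mathcal{F}))\subseteq \mathcal{C}(\mathrm{Inc}(\mathcal{F}))$.
   Context: $\mathbb{N}=\{1,2,\dots\}$; $\binom{\mathbb{N}}{d}$ is the set of $d$-subsets of $\mathbb{N}$, each written $\mathbf{u}=(u_1,\dots,u_d)$ with $u_1<\dots<u_d$. Squashed order: $\mathbf{u}<\mathbf{v}$ if the largest element of the symmetric difference of $\mathbf{u}$ and $\mathbf{v}$ lies in $\mathbf{v}$. For a finite family $\mathcal{F}\subseteq\binom{\mathbb{N}}{d}$, its compression $\mathcal{C}(\mathcal{F})$ is the set of the $|\mathcal{F}|$ smallest elements of $\binom{\mathbb{N}}{d}$ in the squashed order. $\mathrm{Inc}_1$ is the set of maps $\pi:\mathbb{N}\to\mathbb{N}$ with $\pi(j)<\pi(j+1)$ and $\pi(j)\le j+1$ for all $j$, acting by $\pi(\mathbf{u})=(\pi(u_1),\dots,\pi(u_d))$; $\mathrm{Inc}(\mathcal{F})=\{\pi(\mathbf{u})\mid\mathbf{u}\in\mathcal{F},\pi\in\mathrm{Inc}_1\}$ (a finite family). -}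

module Defs where

open import Data.Nat using (ℕ; suc; _≤_; _<_)
open import Data.List using (List; length; map)
open import Data.List.Membership.Propositional using (_∈_; _∉_)
open import Data.List.Relation.Unary.All using (All)
open import Data.List.Relation.Unary.Linked using (Linked)
open import Data.List.Relation.Unary.Unique.Propositional using (Unique)
open import Data.Product using (Σ; ∃; ∃-syntax; _×_)
open import Function.Bundles using (_⇔_)
open import Relation.Binary.PropositionalEquality using (_≡_)

-- A d-subset of ℕ = {1,2,...}, written u = (u₁,…,u_d) with u₁ < … < u_d:
-- a strictly increasing list of positive naturals of length d.
IsDSet : ℕ → List ℕ → Set
IsDSet d u = (length u ≡ d) × Linked _<_ u × All (1 ≤_) u

-- Squashed order: u <ₛ v iff the largest element x of the symmetric
-- difference of u and v lies in v (i.e. x ∈ v, x ∉ u, and u, v agree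
-- on every element larger than x).
_<ₛ_ : List ℕ → List ℕ → Set
u <ₛ v = ∃[ x ] (x ∈ v × x ∉ u × (∀ y → x < y → (y ∈ u ⇔ y ∈ v)))

IsFamily : ℕ → List (List ℕ) → Set
IsFamily d F = Unique F × All (IsDSet d) F

FewerThan : (List ℕ → Set) → ℕ → Set
FewerThan P m = ∀ (L : List (List ℕ)) → Unique L → All P L → length L < m

-- Membership in the compression 𝓒(𝓕) of a family of size m: the m smallest
-- d-sets in the squashed order, i.e. those d-sets v having fewer than m
-- d-sets strictly below them.
InCompression : ℕ → ℕ → List ℕ → Set
InCompression d m v = IsDSet d v × FewerThan (λ w → IsDSet d w × w <ₛ v) m

-- Inc₁ (on ℕ = {1,2,...}): maps π with π(j) < π(j+1) and π(j) ≤ j+1 for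
-- all j ≥ 1, taking values in {1,2,...}. Values at 0 are irrelevant.
IsInc₁ : (ℕ → ℕ) → Set
IsInc₁ π = ∀ j → 1 ≤ j → (1 ≤ π j) × (π j < π (suc j)) × (π j ≤ suc j)

InInc : (List ℕ → Set) → List ℕ → Set
InInc P v = ∃[ u ] ∃[ π ] (P u × IsInc₁ π × map π u ≡ v)

{-# OPTIONS --safe #-}
-- Write ∂ m for the Kruskal–Katona bound: the size of the shadow of the first m
-- d-sets. Bumping some of the largest elements of the first m d-sets yields the
-- first m + ∂ m of them, so Inc(C(F)) is an initial segment and the claim becomes
-- |Inc(F)| ≥ |F| + ∂ |F|. Split F by its largest element n into s sets without n
-- and a sets with n. The members of Inc(F) with maximum at most n contain both F
-- and the Inc of the first part; those with maximum n + 1 contain the Inc of the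
-- links of n. By induction |Inc(F)| ≥ s + max (∂ s) a + (a + ∂ a), the last ∂
-- being taken for (d - 1)-sets, and it remains to prove the Eckhoff–Wegner
-- inequality ∂ (s + a) ≤ max (∂ s) a + ∂ a. It is a purely numerical statement
-- about the binomial recursion for ∂, proved by induction on the ground set
-- together with subadditivity and the exchange inequality for complementary families.
module Submission where

open import Defs
open import Data.Nat using (ℕ; _≤_)
open import Data.List using (List; length)
open import Data.List.Membership.Propositional using (_∈_)
open import Data.List.Relation.Unary.Unique.Propositional using (Unique)
open import Function.Bundles using (_⇔_)

open import Data.Nat using (zero; suc; pred; _+_; _*_; _∸_; _⊔_; _<_; _<′_; _≤′_; ≤′-refl; ≤′-step; z≤n; s≤s; _≤?_; _<?_; _≟_)
open import Data.Nat.Properties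
open import Data.Nat.Tactic.RingSolver using (solve-∀)
open import Data.List using ([]; _∷_; _++_; map; filter; reverse; reverseAcc)
open import Data.List.Properties using (length-++; length-map; length-reverse; filter-accept; filter-reject; map-id-local; reverse-map; reverse-involutive; reverse-injective; ∷-injectiveʳ)
open import Data.List.Membership.Propositional.Properties using (∈-∃++; ∈-++⁻; ∈-++⁺ˡ; ∈-++⁺ʳ; ∈-map⁺; ∈-map⁻; ∈-filter⁺; ∈-filter⁻)
open import Data.List.Relation.Unary.All as All using (All; []; _∷_)
import Data.List.Relation.Unary.All.Properties as Allₚ
open import Data.List.Relation.Unary.AllPairs using (AllPairs; []; _∷_)
open import Data.List.Relation.Unary.Any using (here; there)
open import Data.List.Relation.Unary.Any.Properties using (reverse⁺; reverse⁻)
open import Data.List.Relation.Unary.Linked using (Linked; []; [-]; _∷_)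
open import Data.List.Relation.Unary.Linked.Properties using (AllPairs⇒Linked; Linked⇒AllPairs)
import Data.List.Relation.Unary.Unique.Propositional.Properties as Uniqueₚ
open import Data.Product using (_×_; _,_; proj₁; proj₂; ∃-syntax)
open import Data.Sum using (_⊎_; inj₁; inj₂)
open import Data.Empty using (⊥; ⊥-elim)
open import Function using (_∘_)
open import Function.Bundles using (mk⇔; Equivalence)
open import Relation.Nullary using (Dec; yes; no; ¬_; contradiction)
open import Relation.Nullary.Decidable using (¬?)
open import Relation.Binary using (tri<; tri≈; tri>)
open import Relation.Binary.PropositionalEquality

-- Linear arithmetic without subtraction

-- A certificate for linear arithmetic: the hypotheses are added up to `p ≤ q` and the ring solver
-- checks the identity, so common terms cancel without truncated subtraction.
lin : ∀ {p q l r} → p ≤ q → l + q ≡ r + p → l ≤ r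
lin {p} {q} {l} {r} p≤q eq = +-cancelʳ-≤ q l r (≤-trans (≤-reflexive eq) (+-monoʳ-≤ r p≤q))

linEq : ∀ {p q l r} → p ≡ q → l + q ≡ r + p → l ≡ r
linEq {p} {q} {l} {r} refl eq = +-cancelʳ-≡ q l r eq

data Split (p x : ℕ) : Set where
  low  : x ≤ p → Split p x
  high : ∀ t → x ≡ p + t → 1 ≤ t → Split p x

split : ∀ p x → Split p x
split p x with x ≤? p
... | yes x≤p = low x≤p
... | no  x≰p = high (x ∸ p) (sym (m+[n∸m]≡n (<⇒≤ (≰⇒> x≰p)))) (m<n⇒0<n∸m (≰⇒> x≰p))

excess : ∀ {x p t q} → x ≡ p + t → x ≤ p + q → t ≤ q
excess {p = p} {t} {q} refl x≤p+q = +-cancelˡ-≤ p t q x≤p+q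

complement : ∀ {x p} → x ≤ p → ∃[ y ] x + y ≡ p
complement {x} {p} x≤p = p ∸ x , m+[n∸m]≡n x≤p

-- Binomial coefficients

-- b n j = C(n, j - 1), with b n 0 = 0: the shifted column keeps the Pascal
-- recursion uniform and gives C(n, -1) a value.
b : ℕ → ℕ → ℕ
b n       zero          = 0
b zero    (suc zero)    = 1
b zero    (suc (suc j)) = 0
b (suc n) (suc j)       = b n (suc j) + b n j

-- ∂ n (suc d) x is the size of the shadow of the first x d-subsets of {1, …, n};
-- it is independent of n as long as x ≤ b n (suc d), and junk beyond.
∂ : ℕ → ℕ → ℕ → ℕ
∂ n       zero    x = 0
∂ zero    (suc j) x = 0
∂ (suc n) (suc j) x with x ≤? b n (suc j)
... | yes _ = ∂ n (suc j) x
... | no  _ = b n j + ∂ n j (x ∸ b n (suc j))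

b-pos : ∀ n j → 1 ≤ b n (2 + j) → 1 ≤ b n (1 + j)
b-pos (suc n) j 1≤P+Q with split 0 (b n (2 + j))
... | low  P≤0     = ≤-trans (subst (λ P → 1 ≤ P + b n (1 + j)) (n≤0⇒n≡0 P≤0) 1≤P+Q) (m≤m+n _ _)
... | high t eq 1≤t = ≤-trans (b-pos n j (≤-trans 1≤t (≤-reflexive (sym eq)))) (m≤m+n _ _)

b-pos′ : ∀ n j → 1 ≤ b (suc n) (2 + j) → 1 ≤ b n (1 + j)
b-pos′ n j 1≤P+Q with split 0 (b n (2 + j))
... | low  P≤0     = subst (λ P → 1 ≤ P + b n (1 + j)) (n≤0⇒n≡0 P≤0) 1≤P+Q
... | high t eq 1≤t = b-pos n j (≤-trans 1≤t (≤-reflexive (sym eq)))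

b-mono : ∀ n j → b n j ≤ b (suc n) j
b-mono n zero    = z≤n
b-mono n (suc j) = m≤m+n _ _

-- This is (k + 1) C(n, k + 1) = (n - k) C(n, k) with the subtraction moved to the other side.
b-absorb : ∀ n k → suc k * b n (2 + k) + k * b n (1 + k) ≡ n * b n (1 + k)
b-absorb zero    zero    = refl
b-absorb zero    (suc k) = cong₂ _+_ (*-zeroʳ (2 + k)) (*-zeroʳ (1 + k))
b-absorb (suc n) zero    = linEq (b-absorb n 0) (eq n (b n 2) (b n 1))
  where
  eq : ∀ n p q → (1 * (p + q) + 0) + n * q ≡ (1 + n) * (q + 0) + (1 * p + 0)
  eq = solve-∀
b-absorb (suc n) (suc k) = linEq (cong₂ _+_ (b-absorb n (suc k)) (b-absorb n k)) (eq n k (b n (3 + k)) (b n (2 + k)) (b n (1 + k)))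
  where
  eq : ∀ n k p q r →
    ((2 + k) * (p + q) + (1 + k) * (q + r)) + (n * q + n * r) ≡
    (1 + n) * (q + r) + (((2 + k) * p + (1 + k) * q) + ((1 + k) * q + k * r))
  eq = solve-∀

-- If both outer terms exceeded the middle one, the absorption identities would
-- force both n < 2k + 1 and 2k + 1 ≤ n.
b-unimodal : ∀ n j {x} → x ≤ b n j → x ≤ b n (2 + j) → x ≤ b n (1 + j)
b-unimodal n zero    x≤ _ = ≤-trans x≤ z≤n
b-unimodal n (suc k) {x} x≤R x≤P with x ≤? b n (2 + k)
... | yes x≤Q = x≤Q
... | no  x≰Q with b n (1 + k) | b n (2 + k) | b n (3 + k) | b-absorb n k | b-absorb n (suc k)
...   | R | Q | P | hR | hP = ⊥-elim (<-irrefl refl (<-≤-trans n<2k+1 2k+1≤n))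
  where
  Q<R : Q < R
  Q<R = ≤-trans (≰⇒> x≰Q) x≤R
  Q<P : Q < P
  Q<P = ≤-trans (≰⇒> x≰Q) x≤P
  n<2k+1 : n < 1 + k + k
  n<2k+1 = *-cancelʳ-< R n (1 + k + k) (begin-strict
    n * R                 ≡⟨ hR ⟨
    suc k * Q + k * R     <⟨ +-monoˡ-< (k * R) (*-monoʳ-< (suc k) Q<R) ⟩
    suc k * R + k * R     ≡⟨ *-distribʳ-+ R (suc k) k ⟨
    (1 + k + k) * R       ∎)
    where open ≤-Reasoning
  2k+1≤n : 1 + k + k ≤ n
  2k+1≤n = ≮⇒≥ λ n<2k+1 → <-irrefl refl (begin-strict
    n * Q                       ≤⟨ *-monoˡ-≤ Q (<⇒≤ n<2k+1) ⟩
    (1 + k + k) * Q             ≤⟨ *-monoˡ-≤ Q (n≤1+n (1 + k + k)) ⟩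
    (2 + (k + k)) * Q           ≤⟨ ≤-reflexive (eq k Q) ⟩
    (1 + k) * Q + (1 + k) * Q   <⟨ +-monoˡ-< ((1 + k) * Q) (*-monoʳ-< (1 + k) Q<P) ⟩
    (1 + k) * P + (1 + k) * Q   ≤⟨ +-monoˡ-≤ ((1 + k) * Q) (*-monoˡ-≤ P (n≤1+n (1 + k))) ⟩
    (2 + k) * P + (1 + k) * Q   ≡⟨ hP ⟩
    n * Q                       ∎)
    where
    open ≤-Reasoning
    eq : ∀ k Q → (2 + (k + k)) * Q ≡ (1 + k) * Q + (1 + k) * Q
    eq = solve-∀

-- Values and monotonicity of `∂`

∂-low : ∀ n j {x} → x ≤ b n j → ∂ (suc n) j x ≡ ∂ n j x
∂-low n zero    x≤P = refl
∂-low n (suc j) {x} x≤P with x ≤? b n (suc j)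
... | yes _   = refl
... | no  x≰P = contradiction x≤P x≰P

∂-0 : ∀ n j → ∂ n j 0 ≡ 0
∂-0 n       zero    = refl
∂-0 zero    (suc j) = refl
∂-0 (suc n) (suc j) = trans (∂-low n (suc j) z≤n) (∂-0 n (suc j))

∂-above : ∀ n j {x t} → x ≡ b n (suc j) + t → 1 ≤ t → ∂ (suc n) (suc j) x ≡ b n j + ∂ n j t
∂-above n j {x} {t} refl 1≤t with b n (suc j) + t ≤? b n (suc j)
... | yes P+t≤P = contradiction P+t≤P (<⇒≱ (m<m+n (b n (suc j)) 1≤t))
... | no  _     = cong (λ y → b n j + ∂ n j y) (m+n∸m≡n (b n (suc j)) t)

∂-1 : ∀ n x → ∂ n 1 x ≡ 0
∂-1 zero    x = refl
∂-1 (suc n) x with x ≤? b n 1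
... | yes _ = ∂-1 n x
... | no  _ = refl

∂-full : ∀ n j → 1 ≤ b n (suc j) → ∂ n (suc j) (b n (suc j)) ≡ b n j
∂-full zero    zero    _ = refl
∂-full (suc n) zero    _ = ∂-1 (suc n) (b (suc n) 1)
∂-full (suc n) (suc j) 1≤P+Q = trans (∂-above n (suc j) refl 1≤Q) (cong (b n (suc j) +_) (∂-full n j 1≤Q))
  where
  1≤Q : 1 ≤ b n (suc j)
  1≤Q = b-pos′ n j 1≤P+Q

∂-full-≤ : ∀ n j → ∂ n (suc j) (b n (suc j)) ≤ b n j
∂-full-≤ n j with split 0 (b n (suc j))
... | low P≤0       = ≤-trans (≤-reflexive (trans (cong (∂ n (suc j)) (n≤0⇒n≡0 P≤0)) (∂-0 n (suc j)))) z≤n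
... | high t eq 1≤t = ≤-reflexive (∂-full n j (≤-trans 1≤t (≤-reflexive (sym eq))))

-- Extends `∂-above` to t = 0, where x is the full count and its shadow is all of `b n j`. The value
-- x = 0 is excluded, since the empty family has no shadow while `b n j` may be 1.
∂-high : ∀ n j {x t} → x ≡ b n (suc j) + t → 1 ≤ x → ∂ (suc n) (suc j) x ≡ b n j + ∂ n j t
∂-high n j {x} {suc t} eq   _     = ∂-above n j eq (s≤s z≤n)
∂-high n j {x} {zero}  refl 1≤P+0 = begin
  ∂ (suc n) (suc j) (b n (suc j) + 0)  ≡⟨ ∂-low n (suc j) (≤-reflexive (+-identityʳ _)) ⟩
  ∂ n (suc j) (b n (suc j) + 0)        ≡⟨ cong (∂ n (suc j)) (+-identityʳ _) ⟩
  ∂ n (suc j) (b n (suc j))            ≡⟨ ∂-full n j (subst (1 ≤_) (+-identityʳ _) 1≤P+0) ⟩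
  b n j                                ≡⟨ +-identityʳ _ ⟨
  b n j + 0                            ≡⟨ cong (b n j +_) (∂-0 n j) ⟨
  b n j + ∂ n j 0                      ∎
  where open ≡-Reasoning

∂-high-≤ : ∀ n j {x t} → x ≡ b n (suc j) + t → ∂ (suc n) (suc j) x ≤ b n j + ∂ n j t
∂-high-≤ n j {zero}  {t} eq = ≤-trans (≤-reflexive (∂-0 (suc n) (suc j))) z≤n
∂-high-≤ n j {suc x} {t} eq = ≤-reflexive (∂-high n j eq (s≤s z≤n))

∂-mono-≤ : ∀ n j {x y} → x ≤ y → y ≤ b n j → ∂ n j x ≤ ∂ n j y
∂-mono-≤ n       zero    _ _ = z≤n
∂-mono-≤ zero    (suc j) _ _ = z≤n
∂-mono-≤ (suc n) (suc j) {x} {y} x≤y y≤P+Q with split (b n (suc j)) x | split (b n (suc j)) y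
... | low x≤P       | low y≤P       = subst₂ _≤_ (sym (∂-low n (suc j) x≤P)) (sym (∂-low n (suc j) y≤P)) (∂-mono-≤ n (suc j) x≤y y≤P)
... | low x≤P       | high t y≡ 1≤t = begin
  ∂ (suc n) (suc j) x                  ≡⟨ ∂-low n (suc j) x≤P ⟩
  ∂ n (suc j) x                        ≤⟨ ∂-mono-≤ n (suc j) x≤P ≤-refl ⟩
  ∂ n (suc j) (b n (suc j))            ≤⟨ ∂-full-≤ n j ⟩
  b n j                                ≤⟨ m≤m+n _ _ ⟩
  b n j + ∂ n j t                      ≡⟨ ∂-above n j y≡ 1≤t ⟨
  ∂ (suc n) (suc j) y                  ∎
  where open ≤-Reasoning
... | high s refl 1≤s | low y≤P       = contradiction (≤-trans x≤y y≤P) (<⇒≱ (m<m+n (b n (suc j)) 1≤s))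
... | high s x≡ 1≤s | high t y≡ 1≤t = subst₂ _≤_ (sym (∂-above n j x≡ 1≤s)) (sym (∂-above n j y≡ 1≤t))
  (+-monoʳ-≤ (b n j) (∂-mono-≤ n j (excess x≡ (subst (x ≤_) y≡ x≤y)) (excess y≡ y≤P+Q)))

-- The only possible member of a shadow of singletons is the empty set.
∂-2 : ∀ n x → ∂ n 2 x ≤ b n 1
∂-2 zero    x = z≤n
∂-2 (suc n) x with x ≤? b n 2
... | yes _ = ≤-trans (∂-2 n x) (m≤m+n _ _)
... | no  _ = +-monoʳ-≤ (b n 1) (≤-reflexive (∂-1 n _))

-- Shadow inequalities, by induction on the ground set

-- `remove` compares the shadow losses caused by deleting the last w sets in two
-- consecutive dimensions; `exchange` is submodularity of the shadow size for two
-- families that together cover all subsets. In both, positivity is essential: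
-- the shadow of the empty family is empty even where b n j = 1.
record Inequalities (n : ℕ) : Set where
  field
    mono : ∀ j {x} → x ≤ b n j → x ≤ b n (1 + j) → ∂ n j x ≤ ∂ n (1 + j) x
    remove : ∀ j {w p q} → 1 ≤ b n (2 + j) → w + p ≡ b n (2 + j) → w + q ≡ b n (1 + j) →
      b n j + ∂ n (2 + j) p ≤ b n (1 + j) + ∂ n (1 + j) q
    sub : ∀ j x y → x + y ≤ b n j → ∂ n j (x + y) ≤ ∂ n j x + ∂ n j y
    exchange : ∀ j {x y} r → 1 ≤ b n (1 + j) → x ≤ b n (1 + j) → y ≤ b n (1 + j) → x + y ≡ b n (1 + j) + r →
      b n j + ∂ n (1 + j) r ≤ ∂ n (1 + j) x + ∂ n (1 + j) y

  -- Let P = `b n (2 + j)`, Q = `b n (1 + j)` and y = P - Q. Apply `exchange` to Q + v and y, whose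
  -- total is P + v, and `remove` with w = Q to y; the shadow of y cancels.
  jump : ∀ j v → 1 ≤ b n (2 + j) → b n (1 + j) + v ≤ b n (2 + j) → b n j + ∂ n (2 + j) v ≤ ∂ n (2 + j) (b n (1 + j) + v)
  jump j v 1≤P Q+v≤P with complement (≤-trans (m≤m+n (b n (1 + j)) v) Q+v≤P)
  ... | y , Q+y≡P = lin
    (+-mono-≤ (exchange (1 + j) v 1≤P Q+v≤P (≤-trans (m≤n+m y _) (≤-reflexive Q+y≡P))
                (linEq Q+y≡P (eq₁ (b n (1 + j)) v y (b n (2 + j)))))
              (≤-trans (remove j 1≤P Q+y≡P (+-identityʳ _)) (+-monoʳ-≤ (b n (1 + j)) (≤-reflexive (∂-0 n (1 + j))))))
    (eq₂ (b n (1 + j)) (b n j) (∂ n (2 + j) v) (∂ n (2 + j) y) (∂ n (2 + j) (b n (1 + j) + v)))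
    where
    eq₁ : ∀ Q v y P → ((Q + v) + y) + P ≡ (P + v) + (Q + y)
    eq₁ = solve-∀
    eq₂ : ∀ Q R d e f → (R + d) + ((f + e) + (Q + 0)) ≡ f + ((Q + d) + (R + e))
    eq₂ = solve-∀

module Step (n : ℕ) (ih : Inequalities n) where
  open Inequalities ih

  -- Throughout, P, Q, R, S stand for consecutive entries of row n, in decreasing column order.
  mono′ : ∀ j {x} → x ≤ b (1 + n) j → x ≤ b (1 + n) (1 + j) → ∂ (1 + n) j x ≤ ∂ (1 + n) (1 + j) x
  mono′ zero          _ _ = z≤n
  mono′ (suc zero)    {x} _ _ = ≤-trans (≤-reflexive (∂-1 (1 + n) x)) z≤n
  mono′ (suc (suc k)) {x} x≤Q+R x≤P+Q with split (b n (3 + k)) x | split (b n (2 + k)) x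
  ... | low x≤P | low x≤Q = subst₂ _≤_ (sym (∂-low n (2 + k) x≤Q)) (sym (∂-low n (3 + k) x≤P)) (mono (2 + k) x≤Q x≤P)
  -- Here Q + t = x ≤ P. Two uses of `mono` lift t by two dimensions, unimodality supplying the
  -- middle bound t ≤ Q, and `jump` absorbs R.
  ... | low x≤P | high t x≡ 1≤t = begin
    ∂ (1 + n) (2 + k) x                   ≡⟨ ∂-above n (1 + k) x≡ 1≤t ⟩
    b n (1 + k) + ∂ n (1 + k) t           ≤⟨ +-monoʳ-≤ (b n (1 + k)) (mono (1 + k) t≤R t≤Q) ⟩
    b n (1 + k) + ∂ n (2 + k) t           ≤⟨ +-monoʳ-≤ (b n (1 + k)) (mono (2 + k) t≤Q t≤P) ⟩
    b n (1 + k) + ∂ n (3 + k) t           ≤⟨ jump (1 + k) t (≤-trans 1≤t t≤P) Q+t≤P ⟩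
    ∂ n (3 + k) (b n (2 + k) + t)         ≡⟨ cong (∂ n (3 + k)) x≡ ⟨
    ∂ n (3 + k) x                         ≡⟨ ∂-low n (3 + k) x≤P ⟨
    ∂ (1 + n) (3 + k) x                   ∎
    where
    open ≤-Reasoning
    Q+t≤P : b n (2 + k) + t ≤ b n (3 + k)
    Q+t≤P = subst (_≤ b n (3 + k)) x≡ x≤P
    t≤R : t ≤ b n (1 + k)
    t≤R = excess x≡ x≤Q+R
    t≤P : t ≤ b n (3 + k)
    t≤P = ≤-trans (m≤n+m t _) Q+t≤P
    t≤Q : t ≤ b n (2 + k)
    t≤Q = b-unimodal n (1 + k) t≤R t≤P
  -- Here P + s = x ≤ Q. Subadditivity splits off P, whose shadow is at most Q once `mono` has
  -- lifted it.
  ... | high s x≡ 1≤s | low x≤Q = begin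
    ∂ (1 + n) (2 + k) x                              ≡⟨ ∂-low n (2 + k) x≤Q ⟩
    ∂ n (2 + k) x                                    ≡⟨ cong (∂ n (2 + k)) x≡ ⟩
    ∂ n (2 + k) (b n (3 + k) + s)                    ≤⟨ sub (2 + k) (b n (3 + k)) s P+s≤Q ⟩
    ∂ n (2 + k) (b n (3 + k)) + ∂ n (2 + k) s        ≤⟨ +-monoˡ-≤ (∂ n (2 + k) s) (mono (2 + k) (≤-trans (m≤m+n _ s) P+s≤Q) ≤-refl) ⟩
    ∂ n (3 + k) (b n (3 + k)) + ∂ n (2 + k) s        ≤⟨ +-monoˡ-≤ (∂ n (2 + k) s) (∂-full-≤ n (2 + k)) ⟩
    b n (2 + k) + ∂ n (2 + k) s                      ≡⟨ ∂-above n (2 + k) x≡ 1≤s ⟨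
    ∂ (1 + n) (3 + k) x                              ∎
    where
    open ≤-Reasoning
    P+s≤Q : b n (3 + k) + s ≤ b n (2 + k)
    P+s≤Q = subst (_≤ b n (2 + k)) x≡ x≤Q
  ... | high s x≡P+s 1≤s | high t x≡Q+t 1≤t with complement {s} {b n (2 + k)} (excess x≡P+s x≤P+Q)
  -- The same w separates s from Q and t from P, which is what `remove` compares.
  ...   | w , s+w≡Q = begin
    ∂ (1 + n) (2 + k) x               ≡⟨ ∂-above n (1 + k) x≡Q+t 1≤t ⟩
    b n (1 + k) + ∂ n (1 + k) t       ≤⟨ +-monoʳ-≤ (b n (1 + k)) (mono (1 + k) t≤R t≤Q) ⟩
    b n (1 + k) + ∂ n (2 + k) t       ≤⟨ +-monoʳ-≤ (b n (1 + k)) (mono (2 + k) t≤Q t≤P) ⟩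
    b n (1 + k) + ∂ n (3 + k) t       ≤⟨ remove (1 + k) (≤-trans 1≤t t≤P) w+t≡P (trans (+-comm w s) s+w≡Q) ⟩
    b n (2 + k) + ∂ n (2 + k) s       ≡⟨ ∂-above n (2 + k) x≡P+s 1≤s ⟨
    ∂ (1 + n) (3 + k) x               ∎
    where
    open ≤-Reasoning
    eq : ∀ w s t P Q → (w + t) + ((P + s) + Q) ≡ P + ((Q + t) + (s + w))
    eq = solve-∀
    w+t≡P : w + t ≡ b n (3 + k)
    w+t≡P = linEq (cong₂ _+_ (trans (sym x≡Q+t) x≡P+s) s+w≡Q)
                  (eq w s t (b n (3 + k)) (b n (2 + k)))
    t≤R : t ≤ b n (1 + k)
    t≤R = excess x≡Q+t x≤Q+R
    t≤P : t ≤ b n (3 + k)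
    t≤P = ≤-trans (m≤n+m t w) (≤-reflexive w+t≡P)
    t≤Q : t ≤ b n (2 + k)
    t≤Q = b-unimodal n (1 + k) t≤R t≤P

  -- Since x already fills P, adding y enlarges only the part beyond P, one dimension lower; `sub`
  -- splits it there and `mono` lifts the shadow of y back to its own dimension.
  sub-mixed : ∀ i x y s → x ≡ b n (2 + i) + s → 1 ≤ s → y ≤ b n (2 + i) → x + y ≤ b (1 + n) (2 + i) →
    ∂ (1 + n) (2 + i) (x + y) ≤ ∂ (1 + n) (2 + i) x + ∂ (1 + n) (2 + i) y
  sub-mixed i x y s x≡ 1≤s y≤P x+y≤P+Q = begin
    ∂ (1 + n) (2 + i) (x + y)                                  ≡⟨ ∂-above n (1 + i) x+y≡ (≤-trans 1≤s (m≤m+n s y)) ⟩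
    b n (1 + i) + ∂ n (1 + i) (s + y)                          ≤⟨ +-monoʳ-≤ (b n (1 + i)) (sub (1 + i) s y s+y≤Q) ⟩
    b n (1 + i) + (∂ n (1 + i) s + ∂ n (1 + i) y)              ≡⟨ +-assoc (b n (1 + i)) _ _ ⟨
    b n (1 + i) + ∂ n (1 + i) s + ∂ n (1 + i) y                ≤⟨ +-monoʳ-≤ _ (mono (1 + i) (≤-trans (m≤n+m y s) s+y≤Q) y≤P) ⟩
    b n (1 + i) + ∂ n (1 + i) s + ∂ n (2 + i) y                ≡⟨ cong₂ _+_ (∂-above n (1 + i) x≡ 1≤s) (∂-low n (2 + i) y≤P) ⟨
    ∂ (1 + n) (2 + i) x + ∂ (1 + n) (2 + i) y                  ∎
    where
    open ≤-Reasoning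
    x+y≡ : x + y ≡ b n (2 + i) + (s + y)
    x+y≡ = trans (cong (_+ y) x≡) (+-assoc (b n (2 + i)) s y)
    s+y≤Q : s + y ≤ b n (1 + i)
    s+y≤Q = excess x+y≡ x+y≤P+Q

  sub′ : ∀ j x y → x + y ≤ b (1 + n) j → ∂ (1 + n) j (x + y) ≤ ∂ (1 + n) j x + ∂ (1 + n) j y
  sub′ zero          x y _ = z≤n
  sub′ (suc zero)    x y _ = ≤-trans (≤-reflexive (∂-1 (1 + n) (x + y))) z≤n
  sub′ (suc (suc i)) x y x+y≤P+Q with split (b n (2 + i)) x | split (b n (2 + i)) y
  ... | high s x≡ 1≤s | low y≤P = sub-mixed i x y s x≡ 1≤s y≤P x+y≤P+Q
  ... | low x≤P | high t y≡ 1≤t =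
    subst₂ _≤_ (cong (∂ (1 + n) (2 + i)) (+-comm y x)) (+-comm (∂ (1 + n) (2 + i) y) _)
      (sub-mixed i y x t y≡ 1≤t x≤P (subst (_≤ b (1 + n) (2 + i)) (+-comm x y) x+y≤P+Q))
  ... | low x≤P | low y≤P with split (b n (2 + i)) (x + y)
  ...   | low x+y≤P = subst₂ _≤_ (sym (∂-low n (2 + i) x+y≤P)) (sym (cong₂ _+_ (∂-low n (2 + i) x≤P) (∂-low n (2 + i) y≤P)))
                        (sub (2 + i) x y x+y≤P)
  -- Together the two families overfill P by t, so `exchange` trades them for a full family and one
  -- of size t.
  ...   | high t x+y≡ 1≤t = begin
    ∂ (1 + n) (2 + i) (x + y)                         ≡⟨ ∂-above n (1 + i) x+y≡ 1≤t ⟩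
    b n (1 + i) + ∂ n (1 + i) t                       ≤⟨ +-monoʳ-≤ (b n (1 + i)) (mono (1 + i) (excess x+y≡ x+y≤P+Q) t≤P) ⟩
    b n (1 + i) + ∂ n (2 + i) t                       ≤⟨ exchange (1 + i) t (≤-trans 1≤t t≤P) x≤P y≤P x+y≡ ⟩
    ∂ n (2 + i) x + ∂ n (2 + i) y                     ≡⟨ cong₂ _+_ (∂-low n (2 + i) x≤P) (∂-low n (2 + i) y≤P) ⟨
    ∂ (1 + n) (2 + i) x + ∂ (1 + n) (2 + i) y         ∎
    where
    open ≤-Reasoning
    t≤P : t ≤ b n (2 + i)
    t≤P = excess x+y≡ (+-mono-≤ x≤P y≤P)
  sub′ (suc (suc i)) x y x+y≤P+Q | high s x≡ 1≤s | high t y≡ 1≤t = begin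
    ∂ (1 + n) (2 + i) (x + y)                                  ≡⟨ ∂-above n (1 + i) x+y≡ (≤-trans 1≤s (m≤m+n s _)) ⟩
    b n (1 + i) + ∂ n (1 + i) (s + (b n (2 + i) + t))          ≤⟨ +-monoʳ-≤ (b n (1 + i)) ∂≤ ⟩
    b n (1 + i) + (∂ n (1 + i) s + (b n (1 + i) + ∂ n (1 + i) t)) ≡⟨ +-assoc (b n (1 + i)) _ _ ⟨
    b n (1 + i) + ∂ n (1 + i) s + (b n (1 + i) + ∂ n (1 + i) t) ≡⟨ cong₂ _+_ (∂-above n (1 + i) x≡ 1≤s) (∂-above n (1 + i) y≡ 1≤t) ⟨
    ∂ (1 + n) (2 + i) x + ∂ (1 + n) (2 + i) y                  ∎
    where
    open ≤-Reasoning
    x+y≡ : x + y ≡ b n (2 + i) + (s + (b n (2 + i) + t))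
    x+y≡ = trans (cong₂ _+_ x≡ y≡) (+-assoc (b n (2 + i)) s _)
    s+P+t≤Q : s + (b n (2 + i) + t) ≤ b n (1 + i)
    s+P+t≤Q = excess x+y≡ x+y≤P+Q
    P+t≤Q : b n (2 + i) + t ≤ b n (1 + i)
    P+t≤Q = ≤-trans (m≤n+m _ s) s+P+t≤Q
    -- The copy of P contributed by y sits one dimension lower, where `mono` still bounds its shadow
    -- by Q.
    ∂≤ : ∂ n (1 + i) (s + (b n (2 + i) + t)) ≤ ∂ n (1 + i) s + (b n (1 + i) + ∂ n (1 + i) t)
    ∂≤ = ≤-trans (sub (1 + i) s _ s+P+t≤Q) (+-monoʳ-≤ (∂ n (1 + i) s)
      (≤-trans (sub (1 + i) (b n (2 + i)) t P+t≤Q) (+-monoˡ-≤ (∂ n (1 + i) t)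
        (≤-trans (mono (1 + i) (≤-trans (m≤m+n _ t) P+t≤Q) ≤-refl) (∂-full-≤ n (1 + i))))))

  -- With w = Q - s one has y = w + r. Put p = P - w: `remove` compares p with s, `exchange` at
  -- total P + r pairs y with p, and in the sum Q and the shadow of p cancel.
  exchange-mixed : ∀ i x y r s → 1 ≤ b n (1 + i) → x ≡ b n (2 + i) + s → 1 ≤ s → s ≤ b n (1 + i) → y ≤ b n (2 + i) →
    x + y ≡ b (1 + n) (2 + i) + r →
    b (1 + n) (1 + i) + ∂ (1 + n) (2 + i) r ≤ ∂ (1 + n) (2 + i) x + ∂ (1 + n) (2 + i) y
  exchange-mixed i x y r s 1≤Q x≡ 1≤s s≤Q y≤P x+y≡ with complement s≤Q
  ... | w , s+w≡Q = begin
    (b n (1 + i) + b n i) + ∂ (1 + n) (2 + i) r        ≡⟨ +-assoc (b n (1 + i)) (b n i) _ ⟩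
    b n (1 + i) + (b n i + ∂ (1 + n) (2 + i) r)        ≡⟨ cong (λ z → b n (1 + i) + (b n i + z)) (∂-low n (2 + i) (≤-trans r≤y y≤P)) ⟩
    b n (1 + i) + (b n i + ∂ n (2 + i) r)              ≤⟨ +-monoʳ-≤ (b n (1 + i)) (main (split 0 y)) ⟩
    b n (1 + i) + (∂ n (1 + i) s + ∂ n (2 + i) y)      ≡⟨ +-assoc (b n (1 + i)) _ _ ⟨
    (b n (1 + i) + ∂ n (1 + i) s) + ∂ n (2 + i) y      ≡⟨ cong₂ _+_ (∂-above n (1 + i) x≡ 1≤s) (∂-low n (2 + i) y≤P) ⟨
    ∂ (1 + n) (2 + i) x + ∂ (1 + n) (2 + i) y          ∎
    where
    open ≤-Reasoning
    y≡w+r : y ≡ w + r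
    y≡w+r = linEq (cong₂ _+_ (trans (cong (_+ y) (sym x≡)) x+y≡) (sym s+w≡Q)) (eq (b n (2 + i)) (b n (1 + i)) r s w y)
      where
      eq : ∀ P Q r s w y → y + (((P + Q) + r) + (s + w)) ≡ (w + r) + (((P + s) + y) + Q)
      eq = solve-∀
    r≤y : r ≤ y
    r≤y = ≤-trans (m≤n+m r w) (≤-reflexive (sym y≡w+r))
    w≤y : w ≤ y
    w≤y = ≤-trans (m≤m+n w r) (≤-reflexive (sym y≡w+r))
    main : Split 0 y → b n i + ∂ n (2 + i) r ≤ ∂ n (1 + i) s + ∂ n (2 + i) y
    -- Positivity of P, required by `remove`, comes from y in the other case. If y = 0, then r = w =
    -- 0 and s is the full count Q.
    main (low y≤0) = begin
      b n i + ∂ n (2 + i) r                ≡⟨ cong (λ z → b n i + ∂ n (2 + i) z) (n≤0⇒n≡0 (≤-trans r≤y y≤0)) ⟩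
      b n i + ∂ n (2 + i) 0                ≡⟨ cong (b n i +_) (∂-0 n (2 + i)) ⟩
      b n i + 0                            ≡⟨ +-identityʳ (b n i) ⟩
      b n i                                ≡⟨ ∂-full n i 1≤Q ⟨
      ∂ n (1 + i) (b n (1 + i))            ≡⟨ cong (∂ n (1 + i)) s≡Q ⟨
      ∂ n (1 + i) s                        ≤⟨ m≤m+n _ _ ⟩
      ∂ n (1 + i) s + ∂ n (2 + i) y        ∎
      where
      s≡Q : s ≡ b n (1 + i)
      s≡Q = trans (sym (+-identityʳ s)) (trans (cong (s +_) (sym (n≤0⇒n≡0 (≤-trans w≤y y≤0)))) s+w≡Q)
    main (high _ y≡t 1≤t) with complement (≤-trans w≤y y≤P)
    ... | p , w+p≡P = lin
      (+-mono-≤ (remove i 1≤P w+p≡P (trans (+-comm w s) s+w≡Q))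
                (exchange (1 + i) r 1≤P y≤P (≤-trans (m≤n+m p w) (≤-reflexive w+p≡P)) y+p≡P+r))
      (eq (b n (1 + i)) (b n i) (∂ n (2 + i) r) (∂ n (1 + i) s) (∂ n (2 + i) y) (∂ n (2 + i) p))
      where
      1≤P : 1 ≤ b n (2 + i)
      1≤P = ≤-trans (≤-trans 1≤t (≤-reflexive (sym y≡t))) y≤P
      eq₁ : ∀ P r w y p → (y + p) + ((w + r) + P) ≡ (P + r) + (y + (w + p))
      eq₁ = solve-∀
      y+p≡P+r : y + p ≡ b n (2 + i) + r
      y+p≡P+r = linEq (cong₂ _+_ y≡w+r w+p≡P) (eq₁ (b n (2 + i)) r w y p)
      eq : ∀ Q R dr ds dy dp → (R + dr) + ((Q + ds) + (dy + dp)) ≡ (ds + dy) + ((R + dp) + (Q + dr))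
      eq = solve-∀

  -- This is the case x = P + s, y = P + t of `exchange′` after cancelling one Q. If r exceeds P,
  -- the excess is exchanged one dimension lower. Otherwise P - r equals Q - (s + t), so for
  -- positive P `remove` applies and `sub` separates s from t.
  exchange-high : ∀ i r s t → 1 ≤ b n (1 + i) → s ≤ b n (1 + i) → t ≤ b n (1 + i) →
    s + t + b n (2 + i) ≡ b n (1 + i) + r →
    b n i + ∂ (1 + n) (2 + i) r ≤ b n (1 + i) + (∂ n (1 + i) s + ∂ n (1 + i) t)
  exchange-high i r s t 1≤Q s≤Q t≤Q eq₀ with split (b n (2 + i)) r
  ... | high u r≡ 1≤u = begin
    b n i + ∂ (1 + n) (2 + i) r                      ≡⟨ cong (b n i +_) (∂-above n (1 + i) r≡ 1≤u) ⟩
    b n i + (b n (1 + i) + ∂ n (1 + i) u)            ≡⟨ eq₁ (b n i) (b n (1 + i)) _ ⟩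
    b n (1 + i) + (b n i + ∂ n (1 + i) u)            ≤⟨ +-monoʳ-≤ (b n (1 + i)) (exchange i u 1≤Q s≤Q t≤Q s+t≡Q+u) ⟩
    b n (1 + i) + (∂ n (1 + i) s + ∂ n (1 + i) t)    ∎
    where
    open ≤-Reasoning
    eq₁ : ∀ R Q d → R + (Q + d) ≡ Q + (R + d)
    eq₁ = solve-∀
    eq₂ : ∀ P Q s t u → (s + t) + (Q + (P + u)) ≡ (Q + u) + (s + t + P)
    eq₂ = solve-∀
    s+t≡Q+u : s + t ≡ b n (1 + i) + u
    s+t≡Q+u = linEq (trans eq₀ (cong (b n (1 + i) +_) r≡)) (eq₂ (b n (2 + i)) (b n (1 + i)) s t u)
  ... | low r≤P with split 0 (b n (2 + i))
  ...   | low P≤0 = begin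
    b n i + ∂ (1 + n) (2 + i) r                      ≡⟨ cong (λ z → b n i + ∂ (1 + n) (2 + i) z) (n≤0⇒n≡0 (≤-trans r≤P P≤0)) ⟩
    b n i + ∂ (1 + n) (2 + i) 0                      ≡⟨ cong (b n i +_) (∂-0 (1 + n) (2 + i)) ⟩
    b n i + 0                                        ≡⟨ +-identityʳ (b n i) ⟩
    b n i                                            ≡⟨ ∂-full n i 1≤Q ⟨
    ∂ n (1 + i) (b n (1 + i))                        ≡⟨ cong (∂ n (1 + i)) s+t≡Q ⟨
    ∂ n (1 + i) (s + t)                              ≤⟨ sub (1 + i) s t (≤-reflexive s+t≡Q) ⟩
    ∂ n (1 + i) s + ∂ n (1 + i) t                    ≤⟨ m≤n+m _ (b n (1 + i)) ⟩
    b n (1 + i) + (∂ n (1 + i) s + ∂ n (1 + i) t)    ∎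
    where
    open ≤-Reasoning
    s+t≡Q : s + t ≡ b n (1 + i)
    s+t≡Q = begin-equality
      s + t                 ≡⟨ +-identityʳ (s + t) ⟨
      s + t + 0             ≡⟨ cong (s + t +_) (n≤0⇒n≡0 P≤0) ⟨
      s + t + b n (2 + i)   ≡⟨ eq₀ ⟩
      b n (1 + i) + r       ≡⟨ cong (b n (1 + i) +_) (n≤0⇒n≡0 (≤-trans r≤P P≤0)) ⟩
      b n (1 + i) + 0       ≡⟨ +-identityʳ (b n (1 + i)) ⟩
      b n (1 + i)           ∎
  ...   | high _ P≡ 1≤p with complement r≤P
  ...     | w , r+w≡P = begin
    b n i + ∂ (1 + n) (2 + i) r                      ≡⟨ cong (b n i +_) (∂-low n (2 + i) r≤P) ⟩
    b n i + ∂ n (2 + i) r                            ≤⟨ remove i (≤-trans 1≤p (≤-reflexive (sym P≡))) (trans (+-comm w r) r+w≡P) w+s+t≡Q ⟩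
    b n (1 + i) + ∂ n (1 + i) (s + t)                ≤⟨ +-monoʳ-≤ (b n (1 + i)) (sub (1 + i) s t (≤-trans (m≤n+m _ w) (≤-reflexive w+s+t≡Q))) ⟩
    b n (1 + i) + (∂ n (1 + i) s + ∂ n (1 + i) t)    ∎
    where
    open ≤-Reasoning
    eq₁ : ∀ P Q r s t w → (w + (s + t)) + ((Q + r) + P) ≡ Q + ((s + t + P) + (r + w))
    eq₁ = solve-∀
    w+s+t≡Q : w + (s + t) ≡ b n (1 + i)
    w+s+t≡Q = linEq (cong₂ _+_ eq₀ r+w≡P) (eq₁ (b n (2 + i)) (b n (1 + i)) r s t w)

  exchange′ : ∀ j {x y} r → 1 ≤ b (1 + n) (1 + j) → x ≤ b (1 + n) (1 + j) → y ≤ b (1 + n) (1 + j) →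
    x + y ≡ b (1 + n) (1 + j) + r →
    b (1 + n) j + ∂ (1 + n) (1 + j) r ≤ ∂ (1 + n) (1 + j) x + ∂ (1 + n) (1 + j) y
  exchange′ zero    r _ _ _ _ = ≤-trans (≤-reflexive (∂-1 (1 + n) r)) z≤n
  exchange′ (suc i) {x} {y} r 1≤P+Q x≤P+Q y≤P+Q x+y≡ with split (b n (2 + i)) x | split (b n (2 + i)) y
  ... | high s x≡ 1≤s | low y≤P = exchange-mixed i x y r s (b-pos′ n i 1≤P+Q) x≡ 1≤s (excess x≡ x≤P+Q) y≤P x+y≡
  ... | low x≤P | high t y≡ 1≤t =
    subst (b (1 + n) (1 + i) + ∂ (1 + n) (2 + i) r ≤_) (+-comm (∂ (1 + n) (2 + i) y) _)
      (exchange-mixed i y x r t (b-pos′ n i 1≤P+Q) y≡ 1≤t (excess y≡ y≤P+Q) x≤P (trans (+-comm y x) x+y≡))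
  -- Since y ≤ P, the total leaves Q + r ≤ x ≤ P. Here `jump` pays R for the passage from r to Q +
  -- r, and `exchange` handles the excess Q + r.
  ... | low x≤P | low y≤P = begin
    (b n (1 + i) + b n i) + ∂ (1 + n) (2 + i) r        ≡⟨ +-assoc (b n (1 + i)) (b n i) _ ⟩
    b n (1 + i) + (b n i + ∂ (1 + n) (2 + i) r)        ≡⟨ cong (λ z → b n (1 + i) + (b n i + z)) (∂-low n (2 + i) (≤-trans (m≤n+m r _) Q+r≤P)) ⟩
    b n (1 + i) + (b n i + ∂ n (2 + i) r)              ≤⟨ +-monoʳ-≤ (b n (1 + i)) (jump i r 1≤P Q+r≤P) ⟩
    b n (1 + i) + ∂ n (2 + i) (b n (1 + i) + r)        ≤⟨ exchange (1 + i) _ 1≤P x≤P y≤P (trans x+y≡ (+-assoc (b n (2 + i)) _ r)) ⟩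
    ∂ n (2 + i) x + ∂ n (2 + i) y                      ≡⟨ cong₂ _+_ (∂-low n (2 + i) x≤P) (∂-low n (2 + i) y≤P) ⟨
    ∂ (1 + n) (2 + i) x + ∂ (1 + n) (2 + i) y          ∎
    where
    open ≤-Reasoning
    eq : ∀ P Q r x y → (Q + r) + ((x + y) + P) ≡ x + (((P + Q) + r) + y)
    eq = solve-∀
    Q+r≤P : b n (1 + i) + r ≤ b n (2 + i)
    Q+r≤P = ≤-trans (lin (+-mono-≤ (≤-reflexive (sym x+y≡)) y≤P) (eq (b n (2 + i)) (b n (1 + i)) r x y)) x≤P
    1≤P : 1 ≤ b n (2 + i)
    1≤P = ≤-trans (b-pos′ n i 1≤P+Q) (≤-trans (m≤m+n _ r) Q+r≤P)
  ... | high s x≡ 1≤s | high t y≡ 1≤t = begin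
    (b n (1 + i) + b n i) + ∂ (1 + n) (2 + i) r                    ≤⟨ lin main (eq₁ (b n (1 + i)) (b n i) (∂ (1 + n) (2 + i) r) (∂ n (1 + i) s) (∂ n (1 + i) t)) ⟩
    (b n (1 + i) + ∂ n (1 + i) s) + (b n (1 + i) + ∂ n (1 + i) t)  ≡⟨ cong₂ _+_ (∂-above n (1 + i) x≡ 1≤s) (∂-above n (1 + i) y≡ 1≤t) ⟨
    ∂ (1 + n) (2 + i) x + ∂ (1 + n) (2 + i) y                      ∎
    where
    open ≤-Reasoning
    eq₁ : ∀ Q R dr ds dt → ((Q + R) + dr) + (Q + (ds + dt)) ≡ ((Q + ds) + (Q + dt)) + (R + dr)
    eq₁ = solve-∀
    eq₂ : ∀ P Q r s t → (s + t + P) + ((P + Q) + r) ≡ (Q + r) + ((P + s) + (P + t))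
    eq₂ = solve-∀
    main : b n i + ∂ (1 + n) (2 + i) r ≤ b n (1 + i) + (∂ n (1 + i) s + ∂ n (1 + i) t)
    main = exchange-high i r s t (b-pos′ n i 1≤P+Q) (excess x≡ x≤P+Q) (excess y≡ y≤P+Q)
      (linEq (trans (sym (cong₂ _+_ x≡ y≡)) x+y≡) (eq₂ (b n (2 + i)) (b n (1 + i)) r s t))

  -- Comparing w with Q and R decides whether p still contains a full P and q a full Q: the former
  -- means w ≤ Q, the latter w ≤ R.
  remove′ : ∀ j {w p q} → 1 ≤ b (1 + n) (2 + j) → w + p ≡ b (1 + n) (2 + j) → w + q ≡ b (1 + n) (1 + j) →
    b (1 + n) j + ∂ (1 + n) (2 + j) p ≤ b (1 + n) (1 + j) + ∂ (1 + n) (1 + j) q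
  remove′ zero    {p = p} _ _ _ = ≤-trans (∂-2 (1 + n) p) (m≤m+n _ _)
  remove′ (suc k) {w} {p} {q} 1≤P+Q w+p≡ w+q≡ with split (b n (2 + k)) w | split (b n (1 + k)) w
  ... | low w≤Q | low w≤R with complement w≤Q | complement w≤R
  ...   | p′ , w+p′≡Q | q′ , w+q′≡R = begin
    b n (1 + k) + b n k + ∂ (1 + n) (3 + k) p                      ≤⟨ +-monoʳ-≤ (b n (1 + k) + b n k) (∂-high-≤ n (2 + k) p≡) ⟩
    b n (1 + k) + b n k + (b n (2 + k) + ∂ n (2 + k) p′)           ≤⟨ lin (remove k 1≤Q w+p′≡Q w+q′≡R) (eq₂ (b n (2 + k)) (b n (1 + k)) (b n k) (∂ n (2 + k) p′) (∂ n (1 + k) q′)) ⟩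
    b n (2 + k) + b n (1 + k) + (b n (1 + k) + ∂ n (1 + k) q′)     ≡⟨ cong (b n (2 + k) + b n (1 + k) +_) (∂-high n (1 + k) q≡ 1≤q) ⟨
    b n (2 + k) + b n (1 + k) + ∂ (1 + n) (2 + k) q                ∎
    where
    open ≤-Reasoning
    1≤Q : 1 ≤ b n (2 + k)
    1≤Q = b-pos′ n (1 + k) 1≤P+Q
    eq₁ : ∀ P Q w p p′ → p + ((P + Q) + (w + p′)) ≡ (P + p′) + ((w + p) + Q)
    eq₁ = solve-∀
    p≡ : p ≡ b n (3 + k) + p′
    p≡ = linEq (cong₂ _+_ w+p≡ (sym w+p′≡Q)) (eq₁ (b n (3 + k)) (b n (2 + k)) w p p′)
    q≡ : q ≡ b n (2 + k) + q′
    q≡ = linEq (cong₂ _+_ w+q≡ (sym w+q′≡R)) (eq₁ (b n (2 + k)) (b n (1 + k)) w q q′)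
    1≤q : 1 ≤ q
    1≤q = ≤-trans 1≤Q (≤-trans (m≤m+n _ q′) (≤-reflexive (sym q≡)))
    eq₂ : ∀ Q R S dp dq → (R + S + (Q + dp)) + (R + dq) ≡ (Q + R + (R + dq)) + (S + dp)
    eq₂ = solve-∀
  -- Now p = P + p′ and q = R + p′ with the same p′, and q ≤ Q because w exceeds R; `jump` compares
  -- p′ with q.
  remove′ (suc k) {w} {p} {q} 1≤P+Q w+p≡ w+q≡ | low w≤Q | high w′ w≡ 1≤w′ with complement w≤Q
  ... | p′ , w+p′≡Q = begin
    b n (1 + k) + b n k + ∂ (1 + n) (3 + k) p                      ≤⟨ +-monoʳ-≤ (b n (1 + k) + b n k) (∂-high-≤ n (2 + k) p≡) ⟩
    b n (1 + k) + b n k + (b n (2 + k) + ∂ n (2 + k) p′)           ≤⟨ lin (jump k p′ 1≤Q (subst (_≤ b n (2 + k)) q≡ q≤Q)) (eq₃ (b n (2 + k)) (b n (1 + k)) (b n k) (∂ n (2 + k) p′) (∂ n (2 + k) (b n (1 + k) + p′))) ⟩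
    b n (2 + k) + b n (1 + k) + ∂ n (2 + k) (b n (1 + k) + p′)     ≡⟨ cong (λ z → b n (2 + k) + b n (1 + k) + ∂ n (2 + k) z) q≡ ⟨
    b n (2 + k) + b n (1 + k) + ∂ n (2 + k) q                      ≡⟨ cong (b n (2 + k) + b n (1 + k) +_) (∂-low n (2 + k) q≤Q) ⟨
    b n (2 + k) + b n (1 + k) + ∂ (1 + n) (2 + k) q                ∎
    where
    open ≤-Reasoning
    1≤Q : 1 ≤ b n (2 + k)
    1≤Q = b-pos′ n (1 + k) 1≤P+Q
    eq₁ : ∀ P Q w p p′ → p + ((P + Q) + (w + p′)) ≡ (P + p′) + ((w + p) + Q)
    eq₁ = solve-∀
    p≡ : p ≡ b n (3 + k) + p′
    p≡ = linEq (cong₂ _+_ w+p≡ (sym w+p′≡Q)) (eq₁ (b n (3 + k)) (b n (2 + k)) w p p′)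
    eq₂ : ∀ Q R w q p′ → q + ((Q + R) + (w + p′)) ≡ (R + p′) + ((w + q) + Q)
    eq₂ = solve-∀
    q≡ : q ≡ b n (1 + k) + p′
    q≡ = linEq (cong₂ _+_ w+q≡ (sym w+p′≡Q)) (eq₂ (b n (2 + k)) (b n (1 + k)) w q p′)
    q≤Q : q ≤ b n (2 + k)
    q≤Q = ≤-trans (≤-reflexive q≡) (≤-trans (+-monoˡ-≤ p′ (≤-trans (m≤m+n _ w′) (≤-reflexive (sym w≡)))) (≤-reflexive w+p′≡Q))
    eq₃ : ∀ Q R S dp dq → (R + S + (Q + dp)) + dq ≡ (Q + R + dq) + (S + dp)
    eq₃ = solve-∀
  remove′ (suc k) {w} {p} {q} 1≤P+Q w+p≡ w+q≡ | high u w≡ 1≤u | splitR = go splitR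
    where
    open ≤-Reasoning
    eq₁ : ∀ P Q u p → (u + p) + (P + Q) ≡ P + ((Q + u) + p)
    eq₁ = solve-∀
    eq₂ : ∀ Q R u q → (u + q) + (Q + R) ≡ R + ((Q + u) + q)
    eq₂ = solve-∀
    u+p≡P : u + p ≡ b n (3 + k)
    u+p≡P = linEq (trans (cong (_+ p) (sym w≡)) w+p≡) (eq₁ (b n (3 + k)) (b n (2 + k)) u p)
    u+q≡R : u + q ≡ b n (1 + k)
    u+q≡R = linEq (trans (cong (_+ q) (sym w≡)) w+q≡) (eq₂ (b n (2 + k)) (b n (1 + k)) u q)
    u≤P : u ≤ b n (3 + k)
    u≤P = ≤-trans (m≤m+n u p) (≤-reflexive u+p≡P)
    u≤R : u ≤ b n (1 + k)
    u≤R = ≤-trans (m≤m+n u q) (≤-reflexive u+q≡R)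
    u≤Q : u ≤ b n (2 + k)
    u≤Q = b-unimodal n (1 + k) u≤R u≤P
    -- Passing through e = Q - u compares dimensions that are two apart; R and the shadow of e
    -- cancel.
    twice : b n k + ∂ n (3 + k) p ≤ b n (2 + k) + ∂ n (1 + k) q
    twice with complement u≤Q
    ... | e , u+e≡Q = lin
      (+-mono-≤ (remove (1 + k) (≤-trans 1≤u u≤P) u+p≡P u+e≡Q) (remove k (≤-trans 1≤u u≤Q) u+e≡Q u+q≡R))
      (eq₃ (b n (2 + k)) (b n (1 + k)) (b n k) (∂ n (3 + k) p) (∂ n (2 + k) e) (∂ n (1 + k) q))
      where
      eq₃ : ∀ Q R S dp de dq → (S + dp) + ((Q + de) + (R + dq)) ≡ (Q + dq) + ((R + dp) + (S + de))
      eq₃ = solve-∀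
    -- If w exceeds R, then q ≤ Q and `mono` applies. Otherwise q = Q + q′, and Q is split off by
    -- subadditivity as in `mono′`.
    ∂q≤ : Split (b n (1 + k)) w → ∂ n (1 + k) q ≤ ∂ (1 + n) (2 + k) q
    ∂q≤ (high v w≡R+v 1≤v) = ≤-trans (mono (1 + k) q≤R q≤Q) (≤-reflexive (sym (∂-low n (2 + k) q≤Q)))
      where
      q≤R : q ≤ b n (1 + k)
      q≤R = ≤-trans (m≤n+m q u) (≤-reflexive u+q≡R)
      eq₃ : ∀ Q R v q → (v + q) + (Q + R) ≡ Q + ((R + v) + q)
      eq₃ = solve-∀
      q≤Q : q ≤ b n (2 + k)
      q≤Q = ≤-trans (m≤n+m q v) (≤-reflexive (linEq (trans (cong (_+ q) (sym w≡R+v)) w+q≡) (eq₃ (b n (2 + k)) (b n (1 + k)) v q)))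
    ∂q≤ (low w≤R) with complement w≤R
    ... | q′ , w+q′≡R = begin
      ∂ n (1 + k) q                                   ≡⟨ cong (∂ n (1 + k)) q≡ ⟩
      ∂ n (1 + k) (b n (2 + k) + q′)                  ≤⟨ sub (1 + k) (b n (2 + k)) q′ Q+q′≤R ⟩
      ∂ n (1 + k) (b n (2 + k)) + ∂ n (1 + k) q′      ≤⟨ +-monoˡ-≤ _ (mono (1 + k) (≤-trans (m≤m+n _ q′) Q+q′≤R) ≤-refl) ⟩
      ∂ n (2 + k) (b n (2 + k)) + ∂ n (1 + k) q′      ≤⟨ +-monoˡ-≤ _ (∂-full-≤ n (1 + k)) ⟩
      b n (1 + k) + ∂ n (1 + k) q′                    ≡⟨ ∂-high n (1 + k) q≡ 1≤q ⟨
      ∂ (1 + n) (2 + k) q                             ∎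
      where
      eq₃ : ∀ Q R w q q′ → q + ((Q + R) + (w + q′)) ≡ (Q + q′) + ((w + q) + R)
      eq₃ = solve-∀
      q≡ : q ≡ b n (2 + k) + q′
      q≡ = linEq (cong₂ _+_ w+q≡ (sym w+q′≡R)) (eq₃ (b n (2 + k)) (b n (1 + k)) w q q′)
      Q+q′≤R : b n (2 + k) + q′ ≤ b n (1 + k)
      Q+q′≤R = ≤-trans (≤-reflexive (sym q≡)) (≤-trans (m≤n+m q u) (≤-reflexive u+q≡R))
      1≤q : 1 ≤ q
      1≤q = ≤-trans (b-pos′ n (1 + k) 1≤P+Q) (≤-trans (m≤m+n _ q′) (≤-reflexive (sym q≡)))
    go : Split (b n (1 + k)) w → b (1 + n) (1 + k) + ∂ (1 + n) (3 + k) p ≤ b (1 + n) (2 + k) + ∂ (1 + n) (2 + k) q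
    go s = begin
      b n (1 + k) + b n k + ∂ (1 + n) (3 + k) p                      ≡⟨ +-assoc (b n (1 + k)) (b n k) _ ⟩
      b n (1 + k) + (b n k + ∂ (1 + n) (3 + k) p)                    ≡⟨ cong (λ z → b n (1 + k) + (b n k + z)) (∂-low n (3 + k) (≤-trans (m≤n+m p u) (≤-reflexive u+p≡P))) ⟩
      b n (1 + k) + (b n k + ∂ n (3 + k) p)                          ≤⟨ +-monoʳ-≤ (b n (1 + k)) twice ⟩
      b n (1 + k) + (b n (2 + k) + ∂ n (1 + k) q)                    ≤⟨ +-monoʳ-≤ (b n (1 + k)) (+-monoʳ-≤ (b n (2 + k)) (∂q≤ s)) ⟩
      b n (1 + k) + (b n (2 + k) + ∂ (1 + n) (2 + k) q)              ≡⟨ +-assoc (b n (1 + k)) _ _ ⟨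
      b n (1 + k) + b n (2 + k) + ∂ (1 + n) (2 + k) q                ≡⟨ cong (_+ ∂ (1 + n) (2 + k) q) (+-comm (b n (1 + k)) _) ⟩
      b n (2 + k) + b n (1 + k) + ∂ (1 + n) (2 + k) q                ∎

inequalities : ∀ n → Inequalities n
inequalities zero = record
  { mono     = λ { zero _ _ → z≤n ; (suc j) _ _ → z≤n }
  ; remove   = λ { j () _ _ }
  ; sub      = λ { zero _ _ _ → z≤n ; (suc j) _ _ _ → z≤n }
  ; exchange = λ { zero _ _ _ _ _ → z≤n ; (suc j) _ () _ _ _ }
  }
inequalities (suc n) = record { mono = mono′ ; remove = remove′ ; sub = sub′ ; exchange = exchange′ }
  where open Step n (inequalities n)

-- The Eckhoff-Wegner inequality

b-0≤1 : ∀ j → b 0 j ≤ 1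
b-0≤1 zero          = z≤n
b-0≤1 (suc zero)    = ≤-refl
b-0≤1 (suc (suc j)) = z≤n

⊔-shift : ∀ q {x y a} → q + x ≤ y → q + (x ⊔ a) ≤ y ⊔ (q + a)
⊔-shift q {x} {y} {a} q+x≤y = ≤-trans (≤-reflexive (+-distribˡ-⊔ q x a)) (⊔-monoˡ-≤ (q + a) q+x≤y)

-- Named so that `eckhoff-wegner-straddling` can receive the induction hypothesis as an argument.
-- Here s counts the sets without the largest element and a counts its links.
EckhoffWegner : ℕ → ℕ → Set
EckhoffWegner n j = ∀ {s a} → s + a ≤ b n (1 + j) → a ≤ b n j →
  ∂ n (1 + j) (s + a) ≤ (∂ n (1 + j) s ⊔ a) + ∂ n j a

-- The only case in which the maximum matters: s is at most the number of
-- all d-subsets of {1, …, n}, but s + a exceeds it.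
eckhoff-wegner-straddling : ∀ n i {s a r} → EckhoffWegner n i → s ≤ b n (2 + i) → a ≤ b n (1 + i) → 1 ≤ r → r ≤ b n (1 + i) → s + a ≡ b n (2 + i) + r →
  b n (1 + i) + ∂ n (1 + i) r ≤ (∂ n (2 + i) s ⊔ a) + ∂ n (1 + i) a

eckhoff-wegner-straddling zero i {s} {a} {r} _ s≤0 a≤Q 1≤r r≤Q s+a≡r = begin
  b 0 (1 + i) + 0    ≡⟨ +-identityʳ _ ⟩
  b 0 (1 + i)        ≤⟨ b-0≤1 (1 + i) ⟩
  1                  ≤⟨ 1≤r ⟩
  r                  ≡⟨ s+a≡r ⟨
  s + a              ≡⟨ cong (_+ a) (n≤0⇒n≡0 s≤0) ⟩
  a                  ≡⟨ +-identityʳ a ⟨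
  a + 0              ∎
  where open ≤-Reasoning
eckhoff-wegner-straddling (suc m) i {s} {a} {r} ew s≤P a≤Q 1≤r r≤Q s+a≡ with split (b m (1 + i)) a
-- In row m write P₂, Q₂, R₂ for `b m (2 + i)`, `b m (1 + i)`, `b m i`. Then s = P₂ + s′ with s′ + a
-- = Q₂ + r, an instance of `exchange`.
... | low a≤Q₂ with complement {b m (2 + i)} {s} P₂≤s
  where
  eq : ∀ P Q r s a → (P + r) + (s + a + Q) ≡ s + ((P + Q + r) + a)
  eq = solve-∀
  P₂≤s : b m (2 + i) ≤ s
  P₂≤s = ≤-trans (m≤m+n _ r) (lin (+-mono-≤ (≤-reflexive (sym s+a≡)) a≤Q₂) (eq (b m (2 + i)) (b m (1 + i)) r s a))
...   | s′ , P₂+s′≡s = begin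
  b m (1 + i) + b m i + ∂ (1 + m) (1 + i) r                       ≡⟨ cong (b m (1 + i) + b m i +_) (∂-low m (1 + i) r≤Q₂) ⟩
  b m (1 + i) + b m i + ∂ m (1 + i) r                             ≤⟨ lin (exchange i r (≤-trans (≤-trans 1≤r r≤s′) s′≤Q₂) s′≤Q₂ a≤Q₂ s′+a≡) (eq₂ (b m (1 + i)) (b m i) (∂ m (1 + i) r) (∂ m (1 + i) s′) (∂ m (1 + i) a)) ⟩
  b m (1 + i) + ∂ m (1 + i) s′ + ∂ m (1 + i) a                    ≡⟨ cong₂ _+_ (∂-above m (1 + i) (sym P₂+s′≡s) (≤-trans 1≤r r≤s′)) (∂-low m (1 + i) a≤Q₂) ⟨
  ∂ (1 + m) (2 + i) s + ∂ (1 + m) (1 + i) a                       ≤⟨ +-monoˡ-≤ _ (m≤m⊔n (∂ (1 + m) (2 + i) s) a) ⟩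
  (∂ (1 + m) (2 + i) s ⊔ a) + ∂ (1 + m) (1 + i) a                 ∎
  where
  open ≤-Reasoning
  open Inequalities (inequalities m)
  eq₁ : ∀ P Q r s a → (s + a) + (P + Q + r) ≡ (Q + r) + (P + s + a)
  eq₁ = solve-∀
  s′+a≡ : s′ + a ≡ b m (1 + i) + r
  s′+a≡ = linEq (trans (cong (_+ a) P₂+s′≡s) s+a≡) (eq₁ (b m (2 + i)) (b m (1 + i)) r s′ a)
  s′≤Q₂ : s′ ≤ b m (1 + i)
  s′≤Q₂ = excess (sym P₂+s′≡s) s≤P
  eq₃ : ∀ Q r s a → r + (s + a + Q) ≡ s + (Q + r + a)
  eq₃ = solve-∀
  r≤s′ : r ≤ s′
  r≤s′ = lin (+-mono-≤ (≤-reflexive (sym s′+a≡)) a≤Q₂) (eq₃ (b m (1 + i)) r s′ a)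
  r≤Q₂ : r ≤ b m (1 + i)
  r≤Q₂ = ≤-trans r≤s′ s′≤Q₂
  eq₂ : ∀ Q R dr ds da → (Q + R + dr) + (ds + da) ≡ (Q + ds + da) + (R + dr)
  eq₂ = solve-∀
-- Now a = Q₂ + a′, hence s + a′ = P₂ + r and R₂ cancels; what remains depends on the order of a′
-- and r.
eckhoff-wegner-straddling (suc m) i {s} {a} {r} ew s≤P a≤Q 1≤r r≤Q s+a≡ | high a′ a≡ 1≤a′ = begin
  b m (1 + i) + b m i + ∂ (1 + m) (1 + i) r                       ≤⟨ lin (main (≤-total a′ r)) (eq₁ (b m (1 + i)) (b m i) (∂ (1 + m) (1 + i) r) _ (∂ m i a′)) ⟩
  (∂ (1 + m) (2 + i) s ⊔ a) + (b m i + ∂ m i a′)                  ≡⟨ cong ((∂ (1 + m) (2 + i) s ⊔ a) +_) (∂-above m i a≡ 1≤a′) ⟨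
  (∂ (1 + m) (2 + i) s ⊔ a) + ∂ (1 + m) (1 + i) a                 ∎
  where
  open ≤-Reasoning
  eq₁ : ∀ Q R dr x da → (Q + R + dr) + (x + da) ≡ (x + (R + da)) + (Q + dr)
  eq₁ = solve-∀
  eq₂ : ∀ P Q r s a → (s + a) + (P + Q + r) ≡ (P + r) + (s + (Q + a))
  eq₂ = solve-∀
  s+a′≡ : s + a′ ≡ b m (2 + i) + r
  s+a′≡ = linEq (trans (cong (s +_) (sym a≡)) s+a≡) (eq₂ (b m (2 + i)) (b m (1 + i)) r s a′)
  a′≤R₂ : a′ ≤ b m i
  a′≤R₂ = excess a≡ a≤Q
  a′≤Q : a′ ≤ b (1 + m) (1 + i)
  a′≤Q = ≤-trans (m≤n+m a′ _) (≤-trans (≤-reflexive (sym a≡)) a≤Q)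
  main : a′ ≤ r ⊎ r ≤ a′ → b m (1 + i) + ∂ (1 + m) (1 + i) r ≤ (∂ (1 + m) (2 + i) s ⊔ a) + ∂ m i a′
  -- The induction hypothesis with s = 0 bounds the shadow of a′ by a′ plus its shadow one dimension
  -- lower, and Q₂ + a′ is a.
  main (inj₂ r≤a′) = begin
    b m (1 + i) + ∂ (1 + m) (1 + i) r                        ≤⟨ +-monoʳ-≤ (b m (1 + i)) (∂-mono-≤ (1 + m) (1 + i) r≤a′ a′≤Q) ⟩
    b m (1 + i) + ∂ (1 + m) (1 + i) a′                       ≤⟨ +-monoʳ-≤ (b m (1 + i)) (ew {0} a′≤Q (≤-trans a′≤R₂ (b-mono m i))) ⟩
    b m (1 + i) + ((∂ (1 + m) (1 + i) 0 ⊔ a′) + ∂ (1 + m) i a′) ≡⟨ cong₂ (λ d e → b m (1 + i) + ((d ⊔ a′) + e)) (∂-0 (1 + m) (1 + i)) (∂-low m i a′≤R₂) ⟩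
    b m (1 + i) + (a′ + ∂ m i a′)                            ≡⟨ +-assoc (b m (1 + i)) a′ _ ⟨
    b m (1 + i) + a′ + ∂ m i a′                              ≡⟨ cong (_+ ∂ m i a′) a≡ ⟨
    a + ∂ m i a′                                             ≤⟨ +-monoˡ-≤ _ (m≤n⊔m (∂ (1 + m) (2 + i) s) a) ⟩
    (∂ (1 + m) (2 + i) s ⊔ a) + ∂ m i a′                     ∎
  main (inj₁ a′≤r) with complement a′≤r
  -- Here r = s′ + a′ and s = P₂ + s′. Adding Q₂ inside the maximum turns the shadow of s′ into that
  -- of s, and a′ into a; for s′ = 0 the bound by a suffices.
  ... | s′ , a′+s′≡r = begin
    b m (1 + i) + ∂ (1 + m) (1 + i) r                           ≡⟨ cong (λ z → b m (1 + i) + ∂ (1 + m) (1 + i) z) s′+a′≡r ⟨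
    b m (1 + i) + ∂ (1 + m) (1 + i) (s′ + a′)                   ≤⟨ +-monoʳ-≤ (b m (1 + i)) (ew (≤-trans (≤-reflexive s′+a′≡r) r≤Q) (≤-trans a′≤R₂ (b-mono m i))) ⟩
    b m (1 + i) + ((∂ (1 + m) (1 + i) s′ ⊔ a′) + ∂ (1 + m) i a′) ≡⟨ cong₂ (λ d e → b m (1 + i) + ((d ⊔ a′) + e)) (∂-low m (1 + i) s′≤Q₂) (∂-low m i a′≤R₂) ⟩
    b m (1 + i) + ((∂ m (1 + i) s′ ⊔ a′) + ∂ m i a′)            ≡⟨ +-assoc (b m (1 + i)) _ _ ⟨
    b m (1 + i) + (∂ m (1 + i) s′ ⊔ a′) + ∂ m i a′              ≤⟨ +-monoˡ-≤ (∂ m i a′) (max≤ (split 0 s′)) ⟩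
    (∂ (1 + m) (2 + i) s ⊔ a) + ∂ m i a′                        ∎
    where
    s′+a′≡r : s′ + a′ ≡ r
    s′+a′≡r = trans (+-comm s′ a′) a′+s′≡r
    eq₃ : ∀ P r s s′ a → s + (P + r + (a + s′)) ≡ (P + s′) + (s + a + r)
    eq₃ = solve-∀
    s≡ : s ≡ b m (2 + i) + s′
    s≡ = linEq (cong₂ _+_ s+a′≡ (sym a′+s′≡r)) (eq₃ (b m (2 + i)) r s s′ a′)
    s′≤Q₂ : s′ ≤ b m (1 + i)
    s′≤Q₂ = excess s≡ s≤P
    max≤ : Split 0 s′ → b m (1 + i) + (∂ m (1 + i) s′ ⊔ a′) ≤ ∂ (1 + m) (2 + i) s ⊔ a
    max≤ (high _ s′≡t 1≤t) = ≤-trans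
      (⊔-shift (b m (1 + i)) (≤-reflexive (sym (∂-above m (1 + i) s≡ (≤-trans 1≤t (≤-reflexive (sym s′≡t)))))))
      (≤-reflexive (cong (∂ (1 + m) (2 + i) s ⊔_) (sym a≡)))
    max≤ (low s′≤0) = begin
      b m (1 + i) + (∂ m (1 + i) s′ ⊔ a′)   ≡⟨ cong (λ z → b m (1 + i) + (∂ m (1 + i) z ⊔ a′)) (n≤0⇒n≡0 s′≤0) ⟩
      b m (1 + i) + (∂ m (1 + i) 0 ⊔ a′)    ≡⟨ cong (λ z → b m (1 + i) + (z ⊔ a′)) (∂-0 m (1 + i)) ⟩
      b m (1 + i) + a′                      ≡⟨ a≡ ⟨
      a                                     ≤⟨ m≤n⊔m (∂ (1 + m) (2 + i) s) a ⟩
      ∂ (1 + m) (2 + i) s ⊔ a               ∎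

-- Let P = `b n (2 + i)` and Q = `b n (1 + i)`. If s + a ≤ P and a ≤ Q, induct. If a exceeds Q, the
-- term a already pays for a full shadow Q. If only s + a exceeds P, either s does too and
-- subadditivity beyond P suffices, or the straddling case arises.
eckhoff-wegner : ∀ n j → EckhoffWegner n j
eckhoff-wegner n       zero    {s} {a} _ _ = ≤-trans (≤-reflexive (∂-1 n (s + a))) z≤n
eckhoff-wegner zero    (suc i) _ _ = z≤n
eckhoff-wegner (suc n) (suc i) {s} {a} s+a≤P+Q a≤Q+R with split (b n (2 + i)) (s + a) | split (b n (1 + i)) a
... | low s+a≤P | low a≤Q = begin
  ∂ (1 + n) (2 + i) (s + a)                           ≡⟨ ∂-low n (2 + i) s+a≤P ⟩
  ∂ n (2 + i) (s + a)                                 ≤⟨ eckhoff-wegner n (suc i) s+a≤P a≤Q ⟩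
  (∂ n (2 + i) s ⊔ a) + ∂ n (1 + i) a                 ≡⟨ cong₂ (λ d e → (d ⊔ a) + e) (∂-low n (2 + i) (≤-trans (m≤m+n s a) s+a≤P)) (∂-low n (1 + i) a≤Q) ⟨
  (∂ (1 + n) (2 + i) s ⊔ a) + ∂ (1 + n) (1 + i) a     ∎
  where open ≤-Reasoning
... | low s+a≤P | high _ a≡ _ = begin
  ∂ (1 + n) (2 + i) (s + a)                           ≡⟨ ∂-low n (2 + i) s+a≤P ⟩
  ∂ n (2 + i) (s + a)                                 ≤⟨ ∂-mono-≤ n (2 + i) s+a≤P ≤-refl ⟩
  ∂ n (2 + i) (b n (2 + i))                           ≤⟨ ∂-full-≤ n (1 + i) ⟩
  b n (1 + i)                                         ≤⟨ ≤-trans (m≤m+n _ _) (≤-reflexive (sym a≡)) ⟩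
  a                                                   ≤⟨ m≤n⊔m (∂ (1 + n) (2 + i) s) a ⟩
  ∂ (1 + n) (2 + i) s ⊔ a                             ≤⟨ m≤m+n _ _ ⟩
  (∂ (1 + n) (2 + i) s ⊔ a) + ∂ (1 + n) (1 + i) a     ∎
  where open ≤-Reasoning
... | high r s+a≡ 1≤r | high t a≡ 1≤t = begin
  ∂ (1 + n) (2 + i) (s + a)                           ≡⟨ ∂-above n (1 + i) s+a≡ 1≤r ⟩
  b n (1 + i) + ∂ n (1 + i) r                         ≡⟨ cong (b n (1 + i) +_) (∂-low n (1 + i) r≤Q) ⟨
  b n (1 + i) + ∂ (1 + n) (1 + i) r                   ≤⟨ +-mono-≤ (≤-trans Q≤a (m≤n⊔m (∂ (1 + n) (2 + i) s) a)) (∂-mono-≤ (1 + n) (1 + i) (≤-trans r≤Q Q≤a) a≤Q+R) ⟩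
  (∂ (1 + n) (2 + i) s ⊔ a) + ∂ (1 + n) (1 + i) a     ∎
  where
  open ≤-Reasoning
  r≤Q : r ≤ b n (1 + i)
  r≤Q = excess s+a≡ s+a≤P+Q
  Q≤a : b n (1 + i) ≤ a
  Q≤a = ≤-trans (m≤m+n _ t) (≤-reflexive (sym a≡))
... | high r s+a≡ 1≤r | low a≤Q with split (b n (2 + i)) s
...   | low s≤P = begin
  ∂ (1 + n) (2 + i) (s + a)                           ≡⟨ ∂-above n (1 + i) s+a≡ 1≤r ⟩
  b n (1 + i) + ∂ n (1 + i) r                         ≤⟨ eckhoff-wegner-straddling n i (eckhoff-wegner n i) s≤P a≤Q 1≤r (excess s+a≡ s+a≤P+Q) s+a≡ ⟩
  (∂ n (2 + i) s ⊔ a) + ∂ n (1 + i) a                 ≡⟨ cong₂ (λ d e → (d ⊔ a) + e) (∂-low n (2 + i) s≤P) (∂-low n (1 + i) a≤Q) ⟨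
  (∂ (1 + n) (2 + i) s ⊔ a) + ∂ (1 + n) (1 + i) a     ∎
  where open ≤-Reasoning
...   | high s′ s≡ 1≤s′ = begin
  ∂ (1 + n) (2 + i) (s + a)                           ≡⟨ ∂-above n (1 + i) s+a≡P+s′+a (≤-trans 1≤s′ (m≤m+n s′ a)) ⟩
  b n (1 + i) + ∂ n (1 + i) (s′ + a)                  ≤⟨ +-monoʳ-≤ (b n (1 + i)) (Inequalities.sub (inequalities n) (1 + i) s′ a (excess s+a≡P+s′+a s+a≤P+Q)) ⟩
  b n (1 + i) + (∂ n (1 + i) s′ + ∂ n (1 + i) a)      ≡⟨ +-assoc (b n (1 + i)) _ _ ⟨
  b n (1 + i) + ∂ n (1 + i) s′ + ∂ n (1 + i) a        ≡⟨ cong₂ _+_ (∂-above n (1 + i) s≡ 1≤s′) (∂-low n (1 + i) a≤Q) ⟨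
  ∂ (1 + n) (2 + i) s + ∂ (1 + n) (1 + i) a           ≤⟨ +-monoˡ-≤ _ (m≤m⊔n (∂ (1 + n) (2 + i) s) a) ⟩
  (∂ (1 + n) (2 + i) s ⊔ a) + ∂ (1 + n) (1 + i) a     ∎
  where
  open ≤-Reasoning
  s+a≡P+s′+a : s + a ≡ b n (2 + i) + (s′ + a)
  s+a≡P+s′+a = trans (cong (_+ a) s≡) (+-assoc (b n (2 + i)) s′ a)

-- Stability in the ground set, and counting of duplicate-free lists

b-1 : ∀ n → b n 1 ≡ 1
b-1 zero    = refl
b-1 (suc n) = trans (+-identityʳ _) (b-1 n)

b-mono-≤ : ∀ {m n} j → m ≤ n → b m j ≤ b n j
b-mono-≤ j m≤n = go (≤⇒≤′ m≤n)
  where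
  go : ∀ {m n} → m ≤′ n → b m j ≤ b n j
  go ≤′-refl           = ≤-refl
  go (≤′-step {n} m≤n) = ≤-trans (go m≤n) (b-mono n j)

∂-stable : ∀ {m n} j {x} → m ≤ n → x ≤ b m j → ∂ n j x ≡ ∂ m j x
∂-stable {m} j {x} m≤n x≤b = go (≤⇒≤′ m≤n)
  where
  go : ∀ {n} → m ≤′ n → ∂ n j x ≡ ∂ m j x
  go ≤′-refl           = refl
  go (≤′-step {n} m≤n) = trans (∂-low n j (≤-trans x≤b (b-mono-≤ j (≤′⇒≤ m≤n)))) (go m≤n)

unique-⊆⇒length≤ : ∀ {A : Set} {xs ys : List A} → Unique xs → (∀ {x} → x ∈ xs → x ∈ ys) → length xs ≤ length ys
unique-⊆⇒length≤ {xs = []}     _           _   = z≤n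
unique-⊆⇒length≤ {xs = x ∷ xs} (x∉ ∷ uniq) sub with ∈-∃++ (sub (here refl))
... | as , bs , refl = begin
  suc (length xs)               ≤⟨ s≤s (unique-⊆⇒length≤ uniq sub′) ⟩
  suc (length (as ++ bs))       ≡⟨ cong suc (length-++ as) ⟩
  suc (length as + length bs)   ≡⟨ +-suc (length as) (length bs) ⟨
  length as + suc (length bs)   ≡⟨ length-++ as ⟨
  length (as ++ x ∷ bs)         ∎
  where
  open ≤-Reasoning
  sub′ : ∀ {y} → y ∈ xs → y ∈ as ++ bs
  sub′ y∈xs with ∈-++⁻ as (sub (there y∈xs))
  ... | inj₁ y∈as             = ∈-++⁺ˡ y∈as
  ... | inj₂ (here refl)      = contradiction refl (All.lookup x∉ y∈xs)
  ... | inj₂ (there y∈bs)     = ∈-++⁺ʳ as y∈bs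

-- Descending lists and links

-- d-subsets of {1, …, n}, listed from the largest element down.
infixr 5 _∷_
data Desc : ℕ → ℕ → List ℕ → Set where
  []  : ∀ {n} → Desc n 0 []
  _∷_ : ∀ {n d x u} → suc x ≤ n → Desc x d u → Desc n (suc d) (suc x ∷ u)

Desc-weaken : ∀ {m n d u} → m ≤ n → Desc m d u → Desc n d u
Desc-weaken m≤n []        = []
Desc-weaken m≤n (x≤ ∷ ds) = ≤-trans x≤ m≤n ∷ ds

Desc-≤ : ∀ {n d u} → Desc n d u → ∀ {y} → y ∈ u → y ≤ n
Desc-≤ (x≤n ∷ ds) (here refl) = x≤n
Desc-≤ (x≤n ∷ ds) (there y∈u) = ≤-trans (Desc-≤ ds y∈u) (≤-trans (n≤1+n _) x≤n)

Desc-length : ∀ {n d u} → Desc n d u → length u ≡ d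
Desc-length []       = refl
Desc-length (_ ∷ ds) = cong suc (Desc-length ds)

Headed : ℕ → List ℕ → Set
Headed x []      = ⊥
Headed x (y ∷ u) = x ≡ y

headed? : ∀ x u → Dec (Headed x u)
headed? x []      = no λ ()
headed? x (y ∷ u) = x ≟ y

-- The link of x among the sets whose largest element is x: lists are descending, so that element is
-- the head.
tailsAt : ℕ → List (List ℕ) → List (List ℕ)
tailsAt x []            = []
tailsAt x ([] ∷ F)      = tailsAt x F
tailsAt x ((y ∷ u) ∷ F) with x ≟ y
... | yes _ = u ∷ tailsAt x F
... | no  _ = tailsAt x F

notAt : ℕ → List (List ℕ) → List (List ℕ)
notAt x = filter (¬? ∘ headed? x)

length-split : ∀ x F → length (notAt x F) + length (tailsAt x F) ≡ length F
length-split x []            = refl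
length-split x ([] ∷ F)      = cong suc (length-split x F)
length-split x ((y ∷ u) ∷ F) with x ≟ y
... | yes x≡y = trans (+-suc _ _) (cong suc (trans
  (cong (λ N → length N + length (tailsAt x F)) (filter-reject (¬? ∘ headed? x) (λ x≢y → x≢y x≡y)))
  (length-split x F)))
... | no  x≢y = trans
  (cong (λ N → length N + length (tailsAt x F)) (filter-accept (¬? ∘ headed? x) x≢y))
  (cong suc (length-split x F))

tailsAt-All : ∀ {P Q : List ℕ → Set} x → (∀ {u} → P (x ∷ u) → Q u) → ∀ {F} → All P F → All Q (tailsAt x F)
tailsAt-All x f {[]}          []       = []
tailsAt-All x f {[] ∷ F}      (_ ∷ ps) = tailsAt-All x f ps
tailsAt-All x f {(y ∷ u) ∷ F} (p ∷ ps) with x ≟ y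
... | yes refl = f p ∷ tailsAt-All x f ps
... | no  _    = tailsAt-All x f ps

tailsAt-unique : ∀ x {F} → Unique F → Unique (tailsAt x F)
tailsAt-unique x {[]}          []         = []
tailsAt-unique x {[] ∷ F}      (_ ∷ uniq) = tailsAt-unique x uniq
tailsAt-unique x {(y ∷ u) ∷ F} (p ∷ uniq) with x ≟ y
... | yes refl = tailsAt-All x (λ ne eq → ne (cong (x ∷_) eq)) p ∷ tailsAt-unique x uniq
... | no  _    = tailsAt-unique x uniq

∈-tailsAt⁺ : ∀ x {u F} → x ∷ u ∈ F → u ∈ tailsAt x F
∈-tailsAt⁺ x {F = (y ∷ v) ∷ F} (here refl) with x ≟ x
... | yes _  = here refl
... | no x≢x = contradiction refl x≢x
∈-tailsAt⁺ x {F = [] ∷ F}      (there p) = ∈-tailsAt⁺ x p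
∈-tailsAt⁺ x {F = (y ∷ v) ∷ F} (there p) with x ≟ y
... | yes _ = there (∈-tailsAt⁺ x p)
... | no  _ = ∈-tailsAt⁺ x p

∈-tailsAt⁻ : ∀ x {u F} → u ∈ tailsAt x F → x ∷ u ∈ F
∈-tailsAt⁻ x {F = [] ∷ F}      p = there (∈-tailsAt⁻ x p)
∈-tailsAt⁻ x {F = (y ∷ v) ∷ F} p with x ≟ y
∈-tailsAt⁻ x {F = (y ∷ v) ∷ F} (here refl) | yes refl = here refl
∈-tailsAt⁻ x {F = (y ∷ v) ∷ F} (there p)   | yes refl = there (∈-tailsAt⁻ x p)
∈-tailsAt⁻ x {F = (y ∷ v) ∷ F} p           | no _     = there (∈-tailsAt⁻ x p)

notAt-All : ∀ {P Q : List ℕ → Set} x → (∀ {u} → ¬ Headed x u → P u → Q u) → ∀ {F} → All P F → All Q (notAt x F)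
notAt-All x f {F} ps = All.zipWith (λ { (nh , p) → f nh p })
  (Allₚ.all-filter (¬? ∘ headed? x) F , Allₚ.filter⁺ (¬? ∘ headed? x) ps)

Desc-lower : ∀ {n d u} → ¬ Headed (suc n) u → Desc (suc n) (suc d) u → Desc n (suc d) u
Desc-lower ¬h (x≤n ∷ ds) = ≤-pred (≤∧≢⇒< x≤n (¬h ∘ sym)) ∷ ds

Desc-tail : ∀ {n d u} → Desc (suc n) (suc d) (suc n ∷ u) → Desc n d u
Desc-tail (_ ∷ ds) = ds

Desc-¬Headed : ∀ {n d u} → Desc n d u → ¬ Headed (suc n) u
Desc-¬Headed (x≤n ∷ _) refl = 1+n≰n x≤n

-- Splitting by whether the largest element of the ground set occurs reproduces Pascal's rule.
count-Desc : ∀ n d {F} → Unique F → All (Desc n d) F → length F ≤ b n (1 + d)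
count-Desc n       zero    {F} uniq ds = subst (length F ≤_) (sym (b-1 n))
  (unique-⊆⇒length≤ {ys = [] ∷ []} uniq λ u∈F → only-empty (All.lookup ds u∈F))
  where
  only-empty : ∀ {u} → Desc n 0 u → u ∈ [] ∷ []
  only-empty [] = here refl
count-Desc zero    (suc d) {[]}    _    _  = z≤n
count-Desc zero    (suc d) {u ∷ F} _    ((() ∷ _) ∷ _)
count-Desc (suc n) (suc d) {F}     uniq ds = subst (_≤ b (suc n) (2 + d)) (length-split (suc n) F)
  (+-mono-≤ (count-Desc n (suc d) (Uniqueₚ.filter⁺ (¬? ∘ headed? (suc n)) uniq) (notAt-All (suc n) Desc-lower ds))
            (count-Desc n d (tailsAt-unique (suc n) uniq) (tailsAt-All (suc n) Desc-tail ds)))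

-- Lower bound for the number of bumped sets

-- Inc on lists from the largest element down: raising a prefix.
data Bump : List ℕ → List ℕ → Set where
  keep : ∀ {u} → Bump u u
  raise : ∀ {x u w} → Bump u w → Bump (x ∷ u) (suc x ∷ w)

Bump-¬Headed : ∀ {n d u w} → Desc n d u → Bump u w → ¬ Headed (2 + n) w
Bump-¬Headed (x≤n ∷ _) keep     refl = 1+n≰n (≤-trans (n≤1+n _) x≤n)
Bump-¬Headed (x≤n ∷ _) (raise _) refl = 1+n≰n x≤n

-- G is any list containing all bumps, so the recursive calls can use two parts of one G: the
-- members headed by `2 + n` contain the bumps of links under a raised head, the others contain the
-- bumps of sets avoiding `suc n`.
count-Bump : ∀ n d F G → Unique F → All (Desc n d) F → (∀ {u w} → u ∈ F → Bump u w → w ∈ G) →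
  length F + ∂ n (1 + d) (length F) ≤ length G
count-Bump n zero F G uniq ds cover = begin
  length F + ∂ n 1 (length F)   ≡⟨ cong (length F +_) (∂-1 n (length F)) ⟩
  length F + 0                  ≡⟨ +-identityʳ _ ⟩
  length F                      ≤⟨ unique-⊆⇒length≤ uniq (λ u∈F → cover u∈F keep) ⟩
  length G                      ∎
  where open ≤-Reasoning
count-Bump zero    (suc e) []      G uniq ds cover = z≤n
count-Bump zero    (suc e) (u ∷ F) G uniq ((() ∷ _) ∷ _) cover
count-Bump (suc n) (suc e) F       G uniq ds cover = begin
  length F + ∂ (1 + n) (2 + e) (length F)                                           ≡⟨ cong (λ m → m + ∂ (1 + n) (2 + e) m) (length-split (suc n) F) ⟨
  -- The total s + a is only known to fit in row `1 + n`; s and a fit in row n separately, which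
  -- brings their shadows down to the recursive calls.
  (s + a) + ∂ (1 + n) (2 + e) (s + a)                                               ≤⟨ +-monoʳ-≤ (s + a) (eckhoff-wegner (1 + n) (1 + e) (+-mono-≤ s≤ a≤) (≤-trans a≤ (b-mono n (1 + e)))) ⟩
  (s + a) + ((∂ (1 + n) (2 + e) s ⊔ a) + ∂ (1 + n) (1 + e) a)                       ≡⟨ cong₂ (λ x y → (s + a) + ((x ⊔ a) + y)) (∂-low n (2 + e) s≤) (∂-low n (1 + e) a≤) ⟩
  (s + a) + ((∂ n (2 + e) s ⊔ a) + ∂ n (1 + e) a)                                   ≡⟨ regroup s a (∂ n (2 + e) s ⊔ a) (∂ n (1 + e) a) ⟩
  (s + (∂ n (2 + e) s ⊔ a)) + (a + ∂ n (1 + e) a)                                   ≤⟨ +-mono-≤ bound-rest bound-top ⟩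
  length (notAt (2 + n) G) + length (tailsAt (2 + n) G)                             ≡⟨ length-split (2 + n) G ⟩
  length G                                                                          ∎
  where
  open ≤-Reasoning
  regroup : ∀ s a x y → (s + a) + (x + y) ≡ (s + x) + (a + y)
  regroup = solve-∀
  F< F∋ : List (List ℕ)
  F< = notAt (suc n) F
  F∋ = tailsAt (suc n) F
  s a : ℕ
  s = length F<
  a = length F∋
  uniq< : Unique F<
  uniq< = Uniqueₚ.filter⁺ (¬? ∘ headed? (suc n)) uniq
  uniq∋ : Unique F∋
  uniq∋ = tailsAt-unique (suc n) uniq
  ds< : All (Desc n (suc e)) F<
  ds< = notAt-All (suc n) Desc-lower ds
  ds∋ : All (Desc n e) F∋
  ds∋ = tailsAt-All (suc n) Desc-tail ds
  s≤ : s ≤ b n (2 + e)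
  s≤ = count-Desc n (suc e) uniq< ds<
  a≤ : a ≤ b n (1 + e)
  a≤ = count-Desc n e uniq∋ ds∋
  cover< : ∀ {u w} → u ∈ F< → Bump u w → w ∈ notAt (2 + n) G
  cover< u∈ bump = ∈-filter⁺ (¬? ∘ headed? (2 + n))
    (cover (proj₁ (∈-filter⁻ (¬? ∘ headed? (suc n)) u∈)) bump) (Bump-¬Headed (All.lookup ds< u∈) bump)
  cover∋ : ∀ {u w} → u ∈ F∋ → Bump u w → w ∈ tailsAt (2 + n) G
  cover∋ u∈ bump = ∈-tailsAt⁺ (2 + n) (cover (∈-tailsAt⁻ (suc n) u∈) (raise bump))
  F⊆ : ∀ {u} → u ∈ F → u ∈ notAt (2 + n) G
  F⊆ u∈ = ∈-filter⁺ (¬? ∘ headed? (2 + n)) (cover u∈ keep) (Desc-¬Headed (All.lookup ds u∈))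
  -- Source of the maximum: this part of G contains the bumps of `F<`, giving s + ∂ s, and also all
  -- of F, giving s + a.
  bound-rest : s + (∂ n (2 + e) s ⊔ a) ≤ length (notAt (2 + n) G)
  bound-rest = ≤-trans (≤-reflexive (+-distribˡ-⊔ s (∂ n (2 + e) s) a)) (⊔-lub
    (count-Bump n (suc e) F< _ uniq< ds< cover<)
    (≤-trans (≤-reflexive (length-split (suc n) F)) (unique-⊆⇒length≤ uniq F⊆)))
  bound-top : a + ∂ n (1 + e) a ≤ length (tailsAt (2 + n) G)
  bound-top = count-Bump n e F∋ _ uniq∋ ds∋ cover∋

-- The squashed order and ranks

infix 4 _≺_
-- Lexicographic order on descending lists: for sets of equal size this is the squashed order, in a
-- form that recurses along the list.
data _≺_ : List ℕ → List ℕ → Set where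
  here  : ∀ {x y u v} → x < y → x ∷ u ≺ y ∷ v
  there : ∀ {x u v} → u ≺ v → x ∷ u ≺ x ∷ v

≺⇒<ₛ : ∀ {n d u v} → Desc n d u → Desc n d v → u ≺ v → u <ₛ v
≺⇒<ₛ {u = .(suc x) ∷ u} {v = .(suc y) ∷ v} (_∷_ {x = x} _ du) (_∷_ {x = y} _ dv) (here x<y) =
  suc y , here refl , (λ y∈ → <⇒≱ x<y (Desc-≤ (≤-refl ∷ du) y∈)) , λ z y<z →
    mk⇔ (λ z∈ → contradiction (Desc-≤ (≤-refl ∷ du) z∈) (<⇒≱ (<-trans x<y y<z)))
        (λ z∈ → contradiction (Desc-≤ (≤-refl ∷ dv) z∈) (<⇒≱ y<z))
≺⇒<ₛ (_∷_ {x = x} _ du) (_ ∷ dv) (there u≺v) with ≺⇒<ₛ du dv u≺v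
... | z , z∈v , z∉u , agree = z , there z∈v ,
  (λ { (here refl) → 1+n≰n (Desc-≤ dv z∈v) ; (there z∈u) → z∉u z∈u }) ,
  λ y z<y → mk⇔ (λ { (here eq) → here eq ; (there y∈) → there (Equivalence.to (agree y z<y) y∈) })
                (λ { (here eq) → here eq ; (there y∈) → there (Equivalence.from (agree y z<y) y∈) })

-- A larger head of u would lie above the witness z, hence in v, whose elements are at most its own
-- head. An equal head is not z, which is missing from u, so it can be removed.
<ₛ⇒≺ : ∀ {n m d u v} → Desc n d u → Desc m d v → u <ₛ v → u ≺ v
<ₛ⇒≺ [] [] (_ , () , _)
<ₛ⇒≺ (_∷_ {x = a} {u = u} _ du) (_∷_ {x = c} {u = v} _ dv) (z , z∈v , z∉u , agree) with <-cmp (suc a) (suc c)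
... | tri< a<c _ _ = here a<c
... | tri> _ _ c<a = contradiction
  (Desc-≤ (≤-refl ∷ dv) (Equivalence.to (agree (suc a) (≤-<-trans (Desc-≤ (≤-refl ∷ dv) z∈v) c<a)) (here refl)))
  (<⇒≱ c<a)
... | tri≈ _ refl _ = there (<ₛ⇒≺ du dv (z , z∈tail z∈v , z∉u ∘ there , λ y z<y →
        mk⇔ (λ y∈ → ∈-tail du y∈ (Equivalence.to (agree y z<y) (there y∈)))
            (λ y∈ → ∈-tail dv y∈ (Equivalence.from (agree y z<y) (there y∈)))))
  where
  z∈tail : z ∈ suc a ∷ v → z ∈ v
  z∈tail (here refl) = contradiction (here refl) z∉u
  z∈tail (there z∈)  = z∈
  ∈-tail : ∀ {e w w′ y} → Desc a e w → y ∈ w → y ∈ suc a ∷ w′ → y ∈ w′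
  ∈-tail dw y∈w (here refl) = contradiction (Desc-≤ dw y∈w) 1+n≰n
  ∈-tail dw y∈w (there y∈)  = y∈

-- The position in the squashed order (combinatorial number system).
rank : List ℕ → ℕ
rank []      = 0
rank (x ∷ u) = b (pred x) (2 + length u) + rank u

-- Each w has its own ground set because `FewerThan` ranges over arbitrary lists; w ≺ v then
-- confines it. Smaller heads give sets counted by `count-Desc`, equal heads recurse on tails,
-- matching the two terms of `rank`.
count-≺ : ∀ {n d v L} → Desc n d v → Unique L → All (λ w → (∃[ m ] Desc m d w) × w ≺ v) L → length L ≤ rank v
count-≺ {L = []}    [] _ _ = z≤n
count-≺ {L = w ∷ L} [] _ ((_ , ()) ∷ _)
count-≺ {L = L} (_∷_ {d = d} {x = x} {u = v} x≤n dv) uniq below = begin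
  length L                                                  ≡⟨ length-split (suc x) L ⟨
  length (notAt (suc x) L) + length (tailsAt (suc x) L)     ≤⟨ +-mono-≤ bound< bound≡ ⟩
  b x (2 + d) + rank v                                      ≡⟨ cong (λ l → b x (2 + l) + rank v) (Desc-length dv) ⟨
  b x (2 + length v) + rank v                               ∎
  where
  open ≤-Reasoning
  lower : ∀ {w} → ¬ Headed (suc x) w → (∃[ m ] Desc m (suc d) w) × w ≺ suc x ∷ v → Desc x (suc d) w
  lower ¬h ((_ , _ ∷ dw) , here y<x) = ≤-pred y<x ∷ dw
  lower ¬h (_ , there _)             = contradiction refl ¬h
  tail : ∀ {w} → (∃[ m ] Desc m (suc d) (suc x ∷ w)) × suc x ∷ w ≺ suc x ∷ v → (∃[ m ] Desc m d w) × w ≺ v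
  tail (_ , here x<x)                = contradiction x<x (<-irrefl refl)
  tail ((_ , _ ∷ dw) , there w≺v)    = (_ , dw) , w≺v
  bound< : length (notAt (suc x) L) ≤ b x (2 + d)
  bound< = count-Desc x (suc d) (Uniqueₚ.filter⁺ (¬? ∘ headed? (suc x)) uniq) (notAt-All (suc x) lower below)
  bound≡ : length (tailsAt (suc x) L) ≤ rank v
  bound≡ = count-≺ dv (tailsAt-unique (suc x) uniq) (tailsAt-All (suc x) tail below)


subsets : ℕ → ℕ → List (List ℕ)
subsets n       zero    = [] ∷ []
subsets zero    (suc d) = []
subsets (suc n) (suc d) = subsets n (suc d) ++ map (suc n ∷_) (subsets n d)

subsets-Desc : ∀ n d {u} → u ∈ subsets n d → Desc n d u
subsets-Desc n       zero    (here refl) = []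
subsets-Desc (suc n) (suc d) u∈ with ∈-++⁻ (subsets n (suc d)) u∈
... | inj₁ u∈< = Desc-weaken (n≤1+n n) (subsets-Desc n (suc d) u∈<)
... | inj₂ u∈∋ with ∈-map⁻ (suc n ∷_) u∈∋
...   | v , v∈ , refl = ≤-refl ∷ subsets-Desc n d v∈

subsets-length : ∀ n d → length (subsets n d) ≡ b n (1 + d)
subsets-length n       zero    = sym (b-1 n)
subsets-length zero    (suc d) = refl
subsets-length (suc n) (suc d) = trans (length-++ (subsets n (suc d)))
  (cong₂ _+_ (subsets-length n (suc d)) (trans (length-map _ (subsets n d)) (subsets-length n d)))

unique-++-map∷ : ∀ {n d xs ys} → Unique xs → Unique ys → (∀ {u} → u ∈ xs → Desc n d u) → Unique (xs ++ map (suc n ∷_) ys)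
unique-++-map∷ {n} ux uy ds = Uniqueₚ.++⁺ ux (Uniqueₚ.map⁺ ∷-injectiveʳ uy) disjoint
  where
  disjoint : ∀ {u} → ¬ (u ∈ _ × u ∈ _)
  disjoint (u∈xs , u∈map) with ∈-map⁻ (suc n ∷_) u∈map
  ... | _ , _ , refl = Desc-¬Headed (ds u∈xs) refl

subsets-unique : ∀ n d → Unique (subsets n d)
subsets-unique n       zero    = [] ∷ []
subsets-unique zero    (suc d) = []
subsets-unique (suc n) (suc d) = unique-++-map∷ (subsets-unique n (suc d)) (subsets-unique n d) (subsets-Desc n (suc d))

-- The explicit list on which a `FewerThan` hypothesis is evaluated; it attains the bound of
-- `count-≺`.
predecessors : List ℕ → List (List ℕ)
predecessors []      = []
predecessors (x ∷ v) = subsets (pred x) (1 + length v) ++ map (x ∷_) (predecessors v)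

predecessors-length : ∀ v → length (predecessors v) ≡ rank v
predecessors-length []      = refl
predecessors-length (x ∷ v) = trans (length-++ (subsets (pred x) (1 + length v)))
  (cong₂ _+_ (subsets-length (pred x) (1 + length v)) (trans (length-map _ (predecessors v)) (predecessors-length v)))

predecessors-sound : ∀ {n d v w} → Desc n d v → w ∈ predecessors v → Desc n d w × w ≺ v
predecessors-sound (_∷_ {x = x} {u = v} x≤n dv) w∈ with ∈-++⁻ (subsets x (1 + length v)) w∈
... | inj₁ w∈< with subsets-Desc x (1 + length v) w∈<
...   | y≤x ∷ dw rewrite Desc-length dv = (≤-trans y≤x (≤-trans (n≤1+n x) x≤n) ∷ dw) , here (s≤s y≤x)
predecessors-sound (_∷_ {x = x} {u = v} x≤n dv) w∈ | inj₂ w∈≡ with ∈-map⁻ (suc x ∷_) w∈≡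
... | w , w∈ , refl with predecessors-sound dv w∈
...   | dw , w≺v = (x≤n ∷ dw) , there w≺v

predecessors-unique : ∀ {n d v} → Desc n d v → Unique (predecessors v)
predecessors-unique []                              = []
predecessors-unique (_∷_ {x = x} {u = v} x≤n dv) =
  unique-++-map∷ (subsets-unique x (1 + length v)) (predecessors-unique dv) (subsets-Desc x (1 + length v))

rank< : ∀ {n d u} → Desc n d u → rank u < b n (1 + d)
rank< {n} [] = ≤-reflexive (sym (b-1 n))
rank< {n} (_∷_ {d = d} {x = x} {u = u} x≤n du) = begin-strict
  b x (2 + length u) + rank u   ≡⟨ cong (λ l → b x (2 + l) + rank u) (Desc-length du) ⟩
  b x (2 + d) + rank u          <⟨ +-monoʳ-< (b x (2 + d)) (rank< du) ⟩
  b (suc x) (2 + d)             ≤⟨ b-mono-≤ (2 + d) x≤n ⟩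
  b n (2 + d)                   ∎
  where open ≤-Reasoning

-- 1 + rank u is the size of the initial segment ending in u; its ∂ is exactly the
-- amount by which raising every element of u increases the rank.
rank-map≤ : ∀ {π n d u} → IsInc₁ π → Desc n d u → rank (map π u) ≤ rank u + ∂ n (1 + d) (1 + rank u)
rank-map≤ inc [] = z≤n
rank-map≤ {π} {n} inc (_∷_ {d = d} {x = x} {u = u} x≤n du) = begin
  b (pred (π (suc x))) (2 + length (map π u)) + rank (map π u)        ≡⟨ cong (λ l → b (pred (π (suc x))) (2 + l) + rank (map π u)) (trans (length-map π u) (Desc-length du)) ⟩
  -- Since π (suc x) ≤ 2 + x, the first term is at most its value in row `suc x`, which Pascal's
  -- rule unfolds.
  b (pred (π (suc x))) (2 + d) + rank (map π u)                       ≤⟨ +-mono-≤ (b-mono-≤ (2 + d) (pred-mono-≤ (proj₂ (proj₂ (inc (suc x) (s≤s z≤n)))))) (rank-map≤ inc du) ⟩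
  (b x (2 + d) + b x (1 + d)) + (rank u + ∂ x (1 + d) (1 + rank u))   ≡⟨ regroup (b x (2 + d)) (b x (1 + d)) (rank u) (∂ x (1 + d) (1 + rank u)) ⟩
  -- The 1 in `1 + rank u` makes the excess over `b x (2 + d)` positive, as `∂-above` requires.
  (b x (2 + d) + rank u) + (b x (1 + d) + ∂ x (1 + d) (1 + rank u))   ≡⟨ cong ((b x (2 + d) + rank u) +_) (∂-above x (1 + d) (sym (+-suc (b x (2 + d)) (rank u))) (s≤s z≤n)) ⟨
  (b x (2 + d) + rank u) + ∂ (suc x) (2 + d) (1 + (b x (2 + d) + rank u)) ≡⟨ cong ((b x (2 + d) + rank u) +_) (∂-stable (2 + d) x≤n (≤-trans (≤-reflexive (sym (+-suc (b x (2 + d)) (rank u)))) (+-monoʳ-≤ (b x (2 + d)) (rank< du)))) ⟨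
  (b x (2 + d) + rank u) + ∂ n (2 + d) (1 + (b x (2 + d) + rank u))   ≡⟨ cong (λ l → (b x (2 + l) + rank u) + ∂ n (2 + d) (1 + (b x (2 + l) + rank u))) (Desc-length du) ⟨
  rank (suc x ∷ u) + ∂ n (2 + d) (1 + rank (suc x ∷ u))               ∎
  where
  open ≤-Reasoning
  regroup : ∀ P Q r e → (P + Q) + (r + e) ≡ (P + r) + (Q + e)
  regroup = solve-∀

-- Translation between `IsDSet` and descending lists

Desc-pos : ∀ {n d u} → Desc n d u → ∀ {y} → y ∈ u → 1 ≤ y
Desc-pos (_ ∷ _)  (here refl) = s≤s z≤n
Desc-pos (_ ∷ du) (there y∈)  = Desc-pos du y∈

IsDSet⇒Desc : ∀ {d u} → IsDSet d u → ∃[ n ] Desc n d (reverse u)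
IsDSet⇒Desc {u = u} (refl , linked , positive) with go u [] (Linked⇒AllPairs <-trans linked) positive
  where
  go : ∀ {k e acc} u → Desc k e acc → AllPairs _<_ u → All (k <_) u → ∃[ n ] Desc n (length u + e) (reverseAcc acc u)
  go []          ds _              _         = _ , ds
  go {e = e} {acc} (suc x ∷ u) ds (x<u ∷ pairs) (k<x ∷ _) with go u (≤-refl ∷ Desc-weaken (≤-pred k<x) ds) pairs x<u
  ... | n , ds′ = n , subst (λ l → Desc n l (reverseAcc (suc x ∷ acc) u)) (+-suc (length u) e) ds′
... | n , ds = n , subst (λ l → Desc n l (reverse u)) (+-identityʳ (length u)) ds

Desc⇒IsDSet : ∀ {n d v} → Desc n d v → IsDSet d (reverse v)
Desc⇒IsDSet {v = v} dv =
  trans (length-reverse v) (Desc-length dv) , AllPairs⇒Linked (go dv [] []) , All.tabulate (Desc-pos dv ∘ reverse⁻)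
  where
  go : ∀ {n d v acc} → Desc n d v → AllPairs _<_ acc → All (n <_) acc → AllPairs _<_ (reverseAcc acc v)
  go []         pairs n<acc = pairs
  go (x<n ∷ ds) pairs n<acc = go ds (All.map (≤-<-trans x<n) n<acc ∷ pairs) (≤-refl ∷ All.map (<-trans x<n) n<acc)

reverse-<ₛ : ∀ {u v} → u <ₛ v → reverse u <ₛ reverse v
reverse-<ₛ (x , x∈v , x∉u , agree) = x , reverse⁺ x∈v , x∉u ∘ reverse⁻ , λ y x<y →
  mk⇔ (reverse⁺ ∘ Equivalence.to (agree y x<y) ∘ reverse⁻) (reverse⁺ ∘ Equivalence.from (agree y x<y) ∘ reverse⁻)

map-reverse-unique : ∀ {L : List (List ℕ)} → Unique L → Unique (map reverse L)
map-reverse-unique = Uniqueₚ.map⁺ reverse-injective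

-- The hypothesis is evaluated on `predecessors`, reversed into ascending order. Together with
-- `rank<⇒FewerThan` this reduces membership in the compression to a bound on the rank.
rank<size : ∀ {d u m} → IsDSet d u → FewerThan (λ w → IsDSet d w × w <ₛ u) m → rank (reverse u) < m
rank<size {d} {u} {m} dset few with IsDSet⇒Desc dset
... | n , du = subst (_< m) (trans (length-map reverse (predecessors (reverse u))) (predecessors-length (reverse u)))
  (few _ (map-reverse-unique (predecessors-unique du)) (Allₚ.map⁺ (All.tabulate below)))
  where
  below : ∀ {w} → w ∈ predecessors (reverse u) → IsDSet d (reverse w) × reverse w <ₛ u
  below {w} w∈ with predecessors-sound du w∈
  ... | dw , w≺u = Desc⇒IsDSet dw , subst (reverse w <ₛ_) (reverse-involutive u) (reverse-<ₛ (≺⇒<ₛ dw du w≺u))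

rank<⇒FewerThan : ∀ {d v m} → IsDSet d v → rank (reverse v) < m → FewerThan (λ w → IsDSet d w × w <ₛ v) m
rank<⇒FewerThan {d} {v} dset r<m L uniq below with IsDSet⇒Desc dset
... | n , dv = ≤-<-trans (subst (_≤ rank (reverse v)) (length-map reverse L)
  (count-≺ dv (map-reverse-unique uniq) (Allₚ.map⁺ (All.map convert below)))) r<m
  where
  convert : ∀ {w} → IsDSet d w × w <ₛ v → (∃[ m ] Desc m d (reverse w)) × reverse w ≺ reverse v
  convert (dw , w<v) with IsDSet⇒Desc dw
  ... | m , dw′ = (m , dw′) , <ₛ⇒≺ dw′ dv (reverse-<ₛ w<v)

common-bound : ∀ {d F} → All (IsDSet d) F → ∃[ n ] All (Desc n d) (map reverse F)
common-bound []       = 0 , []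
common-bound (p ∷ ps) with IsDSet⇒Desc p | common-bound ps
... | m , d | n , ds = m ⊔ n , Desc-weaken (m≤m⊔n m n) d ∷ All.map (Desc-weaken (m≤n⊔m m n)) ds

-- Realizing bumps by maps in Inc₁

-- On positive numbers, Inc₁ consists of these maps and the identity: once a value has been raised,
-- strict growth forces all later ones to be raised.
shiftFrom : ℕ → ℕ → ℕ
shiftFrom k j with j <? k
... | yes _ = j
... | no  _ = suc j

shiftFrom-IsInc₁ : ∀ k → IsInc₁ (shiftFrom k)
shiftFrom-IsInc₁ k j 1≤j with j <? k | suc j <? k
... | yes _  | yes _    = 1≤j , ≤-refl , n≤1+n j
... | yes _  | no  _    = 1≤j , n≤1+n (suc j) , n≤1+n j
... | no j≮k | yes 1+j<k = contradiction (<-trans ≤-refl 1+j<k) j≮k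
... | no _   | no  _    = s≤s z≤n , ≤-refl , ≤-refl

shiftFrom-< : ∀ {k j} → j < k → shiftFrom k j ≡ j
shiftFrom-< {k} {j} j<k with j <? k
... | yes _  = refl
... | no j≮k = contradiction j<k j≮k

shiftFrom-≥ : ∀ {k j} → k ≤ j → shiftFrom k j ≡ suc j
shiftFrom-≥ {k} {j} k≤j with j <? k
... | yes j<k = contradiction j<k (≤⇒≯ k≤j)
... | no _    = refl

-- For `keep` the threshold is placed just above the ground set. The bound k ≤ suc n is the
-- induction invariant: a head prepended to u is then at or above the threshold found for u, so it
-- is raised too.
Bump⇒shiftFrom : ∀ {n d u w} → Desc n d u → Bump u w → ∃[ k ] k ≤ suc n × map (shiftFrom k) u ≡ w
Bump⇒shiftFrom {n} du keep = suc n , ≤-refl , map-id-local (All.tabulate (λ y∈ → shiftFrom-< (s≤s (Desc-≤ du y∈))))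
Bump⇒shiftFrom (x<n ∷ du) (raise bump) with Bump⇒shiftFrom du bump
... | k , k≤x , eq = k , ≤-trans k≤x (≤-trans x<n (n≤1+n _)) , cong₂ _∷_ (shiftFrom-≥ k≤x) eq

Inc-size : ∀ {n d F G} → Unique F → All (Desc n d) (map reverse F) → (∀ v → InInc (_∈ F) v → v ∈ G) →
  length F + ∂ n (1 + d) (length F) ≤ length G
Inc-size {n} {d} {F} {G} uniq ds cover = subst₂ _≤_
  (cong (λ m → m + ∂ n (1 + d) m) (length-map reverse F)) (length-map reverse G)
  (count-Bump n d (map reverse F) (map reverse G) (map-reverse-unique uniq) ds cover′)
  where
  cover′ : ∀ {u w} → u ∈ map reverse F → Bump u w → w ∈ map reverse G
  cover′ {w = w} u∈ bump with ∈-map⁻ reverse u∈ | Bump⇒shiftFrom (All.lookup ds u∈) bump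
  ... | u , u∈F , refl | k , _ , eq = subst (_∈ map reverse G) reverse-πu≡w
    (∈-map⁺ reverse (cover (map (shiftFrom k) u) (u , shiftFrom k , u∈F , shiftFrom-IsInc₁ k , refl)))
    where
    reverse-πu≡w : reverse (map (shiftFrom k) u) ≡ w
    reverse-πu≡w = trans (sym (reverse-map (shiftFrom k) u)) eq

map-IsDSet : ∀ {π d u} → IsInc₁ π → IsDSet d u → IsDSet d (map π u)
map-IsDSet {π} {u = u} inc (len , linked , positive) =
  trans (length-map π u) len , linked-map linked positive , Allₚ.map⁺ (All.map (λ {x} 1≤x → proj₁ (inc x 1≤x)) positive)
  where
  π-mono : ∀ {x y} → 1 ≤ x → x <′ y → π x < π y
  π-mono {x} 1≤x ≤′-refl           = proj₁ (proj₂ (inc x 1≤x))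
  π-mono {x} 1≤x (≤′-step {y} x<y) = <-trans (π-mono 1≤x x<y) (proj₁ (proj₂ (inc y (≤-trans 1≤x (<⇒≤ (≤′⇒≤ x<y))))))
  linked-map : ∀ {u} → Linked _<_ u → All (1 ≤_) u → Linked _<_ (map π u)
  linked-map []          _          = []
  linked-map [-]         _          = [-]
  linked-map (x<y ∷ lnk) (1≤x ∷ ps) = π-mono 1≤x (≤⇒≤′ x<y) ∷ linked-map lnk ps

theorem3p5 : (d : ℕ) → 1 ≤ d → (F : List (List ℕ)) → IsFamily d F →
    (G : List (List ℕ)) → Unique G → (∀ v → v ∈ G ⇔ InInc (λ u → u ∈ F) v) →
    ∀ v → InInc (InCompression d (length F)) v → InCompression d (length G) v
theorem3p5 d _ F (uniqF , dsetsF) G _ G⇔Inc v (u , π , (dset-u , few) , inc , refl)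
  with IsDSet⇒Desc dset-u | common-bound dsetsF
... | n₁ , du | n₂ , dF = map-IsDSet inc dset-u , rank<⇒FewerThan (map-IsDSet inc dset-u) (begin
    1 + rank (reverse (map π u))                                 ≡⟨ cong (suc ∘ rank) (reverse-map π u) ⟨
    1 + rank (map π (reverse u))                                 ≤⟨ s≤s (rank-map≤ inc du′) ⟩
    -- Membership in the compression gives 1 + rank ≤ |F|, and `m≤` keeps |F| in the range where `∂`
    -- is monotone.
    1 + rank (reverse u) + ∂ n (1 + d) (1 + rank (reverse u))    ≤⟨ +-mono-≤ r<m (∂-mono-≤ n (1 + d) r<m m≤) ⟩
    length F + ∂ n (1 + d) (length F)                            ≤⟨ Inc-size uniqF dF′ (Equivalence.from ∘ G⇔Inc) ⟩
    length G                                                     ∎)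
  where
  open ≤-Reasoning
  -- A common ground set for u and F, so that a single `∂ n` serves both.
  n : ℕ
  n = n₁ ⊔ n₂
  du′ : Desc n d (reverse u)
  du′ = Desc-weaken (m≤m⊔n n₁ n₂) du
  dF′ : All (Desc n d) (map reverse F)
  dF′ = All.map (Desc-weaken (m≤n⊔m n₁ n₂)) dF
  r<m : rank (reverse u) < length F
  r<m = rank<size dset-u few
  m≤ : length F ≤ b n (1 + d)
  m≤ = subst (_≤ b n (1 + d)) (length-map reverse F) (count-Desc n d (map-reverse-unique uniqF) dF′)
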